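{- Let $r, d \ge 2$ be integers. There exist $d+1$ sets $X_1, \ldots, X_{d+1}$, each consisting of $r$ hyperplanes in $\mathbb{R}^d$, such that their union (a family of $r(d+1)$ hyperplanes) is in general position and the following holds. For any partition of the union $X_1 \cup \cdots \cup X_{d+1}$ into $r$ sets $A_1, \ldots, A_r$ such that each $A_j$ contains exactly one hyperplane of each $X_i$, there are two sets $A_j, A_{j'}$ with $j\neq j'$ whose induced simplices do not intersect, i.e. $\triangle(A_j) \cap \triangle(A_{j'}) = \emptyset$.
   Context: Hyperplanes are affine hyperplanes. A family of hyperplanes in $\mathbb{R}^d$ is in general position if the normal vectors of any $d$ hyperplanes of the family are linearly independent and no $d+1$ hyperplanes of the family have a common point. For a set $A$ of $d+1$ hyperplanes in general position, the induced simplex $\triangle(A)$ is the (closed) $d$-dimensional simplex bounded by them, i.e. the convex hull of the $d+1$ points obtained by intersecting each of the $d+1$ subfamilies of $d$ hyperplanes of $A$. -}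

module Defs where

open import Algebra.Apartness.Bundles using (HeytingCommutativeRing; HeytingField)
open import Algebra.Apartness.Structures using (IsHeytingField)
open import Algebra.Core using (Op₁; Op₂)
open import Algebra.Bundles using (CommutativeRing)
import Algebra.Definitions.RawMonoid as RawMonoidDefs
open import Data.Fin.Base using (Fin)
open import Data.Nat.Base as ℕ using (ℕ; suc)
open import Data.Product using (∃; ∃-syntax; ∃!; _×_; proj₁)
open import Data.Sum.Base using (_⊎_)
open import Data.Vec.Functional using (Vector)
open import Function.Base using (_∘_)
open import Function.Definitions using (Injective)
open import Level using (_⊔_) renaming (suc to lsuc)
open import Relation.Binary.Core using (Rel)
open import Relation.Binary.PropositionalEquality.Core using (_≡_; _≢_)
open import Relation.Binary.Structures using (IsStrictPartialOrder)
open import Relation.Nullary.Negation using (¬_)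

-- The real numbers, given by their constructive axiomatization as a
-- Cauchy-complete Archimedean ordered field whose apartness relation is
-- x < y ⊎ y < x.  Classically these axioms determine ℝ up to isomorphism;
-- constructively they hold, for instance, of Bishop's reals.  No decidability
-- or trichotomy of the order is assumed.
record RealNumbers c ℓ₁ ℓ₂ : Set (lsuc (c ⊔ ℓ₁ ⊔ ℓ₂)) where
  infix  8 -_
  infixl 7 _*_
  infixl 6 _+_
  infix  4 _≈_ _<_ _≤_ _#_
  field
    Carrier : Set c
    _≈_     : Rel Carrier ℓ₁
    _<_     : Rel Carrier ℓ₂
    _+_     : Op₂ Carrier
    _*_     : Op₂ Carrier
    -_      : Op₁ Carrier
    0#      : Carrier
    1#      : Carrier

  _#_ : Rel Carrier ℓ₂
  x # y = x < y ⊎ y < x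

  _≤_ : Rel Carrier ℓ₂
  x ≤ y = ¬ (y < x)

  field
    isHeytingField         : IsHeytingField _≈_ _#_ _+_ _*_ -_ 0# 1#
    <-isStrictPartialOrder : IsStrictPartialOrder _≈_ _<_
    +-monoˡ-<              : ∀ {x y} z → x < y → x + z < y + z
    *-positive             : ∀ {x y} → 0# < x → 0# < y → 0# < x * y

  heytingField : HeytingField c ℓ₁ ℓ₂
  heytingField = record { isHeytingField = isHeytingField }

  open HeytingField heytingField public using (heytingCommutativeRing)
  open HeytingCommutativeRing heytingCommutativeRing public
    using (commutativeRing)
  open CommutativeRing commutativeRing public
    using (_-_; +-rawMonoid; setoid)
  open RawMonoidDefs +-rawMonoid public
    using (sum) renaming (_×_ to _·_)

  -- The bound is required for both (m , n) and (n , m), so it bounds the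
  -- absolute value of the difference.
  Cauchy : (ℕ → Carrier) → Set (c ⊔ ℓ₂)
  Cauchy s = ∀ ε → 0# < ε →
    ∃[ N ] (∀ m n → N ℕ.≤ m → N ℕ.≤ n → s m - s n < ε)

  _ConvergesTo_ : (ℕ → Carrier) → Carrier → Set (c ⊔ ℓ₂)
  s ConvergesTo l = ∀ ε → 0# < ε →
    ∃[ N ] (∀ n → N ℕ.≤ n → (s n - l < ε) × (l - s n < ε))

  field
    archimedean : ∀ x → ∃[ n ] (x < n · 1#)
    complete    : ∀ s → Cauchy s → ∃[ l ] (s ConvergesTo l)

module Geometry {c ℓ₁ ℓ₂} (R : RealNumbers c ℓ₁ ℓ₂) where

  open RealNumbers R
  open import Data.Vec.Functional.Relation.Binary.Equality.Setoid setoid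
    using (_≋_)

  Point : ℕ → Set c
  Point d = Vector Carrier d

  0ᵛ : ∀ {d} → Point d
  0ᵛ _ = 0#

  _∙_ : ∀ {d} → Point d → Point d → Carrier
  u ∙ v = sum (λ k → u k * v k)

  linearCombination : ∀ {n d} → Vector Carrier n → Vector (Point d) n → Point d
  linearCombination a v k = sum (λ i → a i * v i k)

  LinearlyIndependent : ∀ {n d} → Vector (Point d) n → Set (c ⊔ ℓ₁)
  LinearlyIndependent v =
    ∀ a → linearCombination a v ≋ 0ᵛ → ∀ i → a i ≈ 0#

  -- The affine hyperplane { x | normal ∙ x ≈ offset }.
  record Hyperplane (d : ℕ) : Set (c ⊔ ℓ₂) where
    field
      normal   : Point d
      offset   : Carrier
      normal#0 : ∃[ k ] (normal k # 0#)

  open Hyperplane public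

  _∈ʰ_ : ∀ {d} → Point d → Hyperplane d → Set ℓ₁
  x ∈ʰ H = normal H ∙ x ≈ offset H

  -- Subfamilies of n members are injective selections of n indices.  When
  -- d ≥ 2 and there are at least d indices, the first clause also forces
  -- differently indexed members to be different hyperplanes, since no two of
  -- them can have proportional normals.
  GeneralPosition : ∀ {i d} {I : Set i} → (I → Hyperplane d) → Set (i ⊔ c ⊔ ℓ₁)
  GeneralPosition {d = d} {I} H =
    (∀ (s : Fin d → I) → Injective _≡_ _≡_ s →
       LinearlyIndependent (normal ∘ H ∘ s)) ×
    (∀ (s : Fin (suc d) → I) → Injective _≡_ _≡_ s →
       ¬ (∃[ x ] (∀ k → x ∈ʰ H (s k))))

  ConvexHull : ∀ {n d} → Vector (Point d) n → Point d → Set (c ⊔ ℓ₁ ⊔ ℓ₂)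
  ConvexHull v x =
    ∃[ w ] ((∀ i → 0# ≤ w i) × (sum w ≈ 1#) × (x ≋ linearCombination w v))

  -- v k is the common point of the d hyperplanes of A other than A k.  In
  -- general position it exists and is unique up to _≋_.
  IsVertices : ∀ {d} → Vector (Hyperplane d) (suc d) →
               Vector (Point d) (suc d) → Set ℓ₁
  IsVertices A v = ∀ k i → i ≢ k → v k ∈ʰ A i

  △ : ∀ {d} → Vector (Hyperplane d) (suc d) → Point d → Set (c ⊔ ℓ₁ ⊔ ℓ₂)
  △ A x = ∃[ v ] (IsVertices A v × ConvexHull v x)

  Disjoint : ∀ {d ℓ} → (P Q : Point d → Set ℓ) → Set (c ⊔ ℓ)
  Disjoint P Q = ∀ x → ¬ (P x × Q x)

-- A partition of the index set Fin m × Fin r of X₁ ∪ ⋯ ∪ Xₘ into r parts,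
-- each meeting every Xᵢ exactly once: part i k is the index j of the part A_j
-- containing the k-th member of Xᵢ.
record TransversalPartition (m r : ℕ) : Set where
  field
    part        : Fin m → Fin r → Fin r
    exactly-one : ∀ i j → ∃! _≡_ (λ k → part i k ≡ j)

  -- The members of A_j, listed by the Xᵢ they come from.
  members : ∀ {a} {A : Set a} → (Fin m → Fin r → A) → Fin r → Vector A m
  members X j i = X i (proj₁ (exactly-one i j))

{-# OPTIONS --safe #-}

-- A hyperplane is given by a node t and a value f, as the set of the x with
-- p(t) = f, where p is the polynomial of degree < d with coefficients x.  For
-- d + 1 hyperplanes with nodes sᵢ and values fᵢ, let wᵢ = ∏_{j≠i} 1/(sⱼ − sᵢ) be
-- the divided difference weights, which annihilate polynomials of degree < d.
-- Then x lies in the induced simplex only if all products wᵢ (fᵢ − p(sᵢ)) vanish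
-- or have the sign of Δ = ∑ wᵢ fᵢ.  The values are ± powers of a huge number, so
-- that the sign of Δ is that of its dominating term; in particular Δ ≠ 0, so that no
-- point lies on all d + 1 hyperplanes.
--
-- On the real line the nodes are placed in the order
--     a′ < X₀ < X₁ ∖ {a′} < X₂ < X₃ < ⋯ < X_d ,
-- where a′ is the first member of X₁; the values on X₀ dominate those on X₂,
-- which dominate all others, and on X₀ and X₂ the first member has a positive
-- value and all other members have a negative one.  Let A and B be two parts
-- that lie on different sides of both dichotomies (first member of X₀ or not)
-- and (a′ or not).  If a point is in both simplices, then its signs on A and B
-- determine those on A with the member of X₀ replaced by the member of B in X₁.
-- They contradict the sign of Δ for these d + 1 nodes, which is given by the
-- member of A in X₂, whenever that one has the suitable sign.  Every partition
-- has parts A and B for which this is the case, possibly with A and B exchanged.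

module Submission where

open import Algebra.Bundles using (CommutativeMonoid; CommutativeRing)
open import Data.Fin.Base as Fin using (Fin; zero; suc; toℕ; combine; punchIn)
import Data.Fin.Properties as Fin
open import Data.Integer.Base as ℤ using (ℤ; +_; -[1+_]; +[1+_]; 0ℤ; 1ℤ)
import Data.Integer.Properties as ℤ
open import Data.Integer.Tactic.RingSolver using (solve-∀)
open import Data.Nat.Base as ℕ using (ℕ; zero; suc; s≤s; z<s; s<s; _!; _∸_)
import Data.Nat.Divisibility as ℕ
import Data.Nat.DivMod as ℕ
import Data.Nat.Properties as ℕ
open import Data.Product using (Σ-syntax; ∃₂; ∃-syntax; _×_; _,_; proj₁; proj₂; uncurry)
open import Data.Sign.Base as Sign using (Sign; opposite)
open import Data.Sign.Properties using (s≢opposite[s]; opposite-involutive)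
open import Data.Sum.Base using (_⊎_; inj₁; inj₂; fromInj₂)
open import Data.Vec.Functional using (Vector; head; tail; removeAt; _∷_)
open import Function.Base using (_∘_)
open import Function.Definitions using (Injective)
open import Relation.Binary.PropositionalEquality as ≡ using (_≡_; _≢_)
open import Relation.Binary.Structures using (IsStrictPartialOrder)
open import Relation.Nullary.Decidable.Core using (yes; no)
open import Relation.Nullary.Negation using (¬_; contradiction)
open import Defs

-- Signs, and integers up to sign.

mark : ∀ {n} → Fin (suc n) → Sign
mark zero    = Sign.+
mark (suc _) = Sign.-

unit : Sign → ℤ
unit s = s ℤ.◃ 1

module IntegerWeights where

  open import Data.Integer.Base using (_+_; _*_; _-_; -_; _<_; ∣_∣; _^_; _◃_)
  open import Relation.Binary.PropositionalEquality
    using (refl; sym; trans; cong; cong₂; subst; module ≡-Reasoning)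
  open import Algebra.Properties.Semiring.Sum ℤ.+-*-semiring public
    using () renaming (sum to sumℤ)
  open import Algebra.Properties.Semiring.Sum ℤ.+-*-semiring
    using (sum; sum-cong-≗; *-distribˡ-sum; ∑-distrib-+; sum-remove)
  open import Algebra.Properties.CommutativeMonoid.Sum ℤ.*-1-commutativeMonoid
    using () renaming (sum to ∏)
  import Algebra.Properties.CommutativeSemigroup ℕ.*-commutativeSemigroup as ℕ*
  import Algebra.Properties.CommutativeSemigroup
    (CommutativeMonoid.commutativeSemigroup ℤ.+-0-commutativeMonoid) as ℤ+
  import Algebra.Properties.CommutativeSemigroup
    (CommutativeMonoid.commutativeSemigroup ℤ.*-1-commutativeMonoid) as ℤ*

  infix 4 _~_

  -- Both numbers are nonzero and their signs agree. Being a record rather than a synonym of the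
  -- inequality, it lets `x` and `y` be inferred.
  record _~_ (x y : ℤ) : Set where
    constructor same-sign
    field 0<x*y : 0ℤ < x * y

  open _~_ public

  0<x,0<y⇒0<x*y : ∀ {x y} → 0ℤ < x → 0ℤ < y → 0ℤ < x * y
  0<x,0<y⇒0<x*y {+[1+ _ ]} {+[1+ _ ]} _ _ = ℤ.+<+ z<s
  0<x,0<y⇒0<x*y {+ 0} (ℤ.+<+ ())
  0<x,0<y⇒0<x*y {+[1+ _ ]} {+ 0} _ (ℤ.+<+ ())

  ≢0⇒~-refl : ∀ {x} → x ≢ 0ℤ → x ~ x
  ≢0⇒~-refl {+ 0}       x≢0 = contradiction refl x≢0
  ≢0⇒~-refl {+[1+ _ ]}  _   = same-sign (ℤ.+<+ z<s)
  ≢0⇒~-refl { -[1+ _ ]} _   = same-sign (ℤ.+<+ z<s)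

  ~-sym : ∀ {x y} → x ~ y → y ~ x
  ~-sym {x} {y} (same-sign p) = same-sign (subst (0ℤ <_) (ℤ.*-comm x y) p)

  ~⇒≢0 : ∀ {x y} → x ~ y → x ≢ 0ℤ
  ~⇒≢0 x~y refl = ℤ.<-irrefl refl (0<x*y x~y)

  -- The product of the two hypotheses is `x * z` times the positive square `y * y`, which cancels.
  ~-trans : ∀ {x y z} → x ~ y → y ~ z → x ~ z
  ~-trans {x} {y} {z} x~y y~z = same-sign
    (ℤ.*-cancelʳ-<-nonNeg (y * y) {{ℤ.nonNegative (ℤ.<⇒≤ (0<x*y (≢0⇒~-refl (~⇒≢0 y~z))))}}
      (subst (0ℤ <_) (eq x y z) (0<x,0<y⇒0<x*y {x * y} {y * z} (0<x*y x~y) (0<x*y y~z))))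
    where
    eq : ∀ x y z → (x * y) * (y * z) ≡ (x * z) * (y * y)
    eq = solve-∀

  ~-*-cong : ∀ {x y u v} → x ~ y → u ~ v → x * u ~ y * v
  ~-*-cong {x} {y} {u} {v} (same-sign p) (same-sign q) =
    same-sign (subst (0ℤ <_) (eq x y u v) (0<x,0<y⇒0<x*y {x * y} {u * v} p q))
    where
    eq : ∀ x y u v → (x * y) * (u * v) ≡ (x * u) * (y * v)
    eq = solve-∀

  ~-neg : ∀ {x y} → x ~ y → - x ~ - y
  ~-neg {x} {y} (same-sign p) = same-sign (subst (0ℤ <_) (eq x y) p)
    where
    eq : ∀ x y → x * y ≡ - x * - y
    eq = solve-∀

  0<⇒~ : ∀ {x y} → 0ℤ < x → 0ℤ < y → x ~ y
  0<⇒~ 0<x 0<y = same-sign (0<x,0<y⇒0<x*y 0<x 0<y)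

  <0⇒~ : ∀ {x y} → x < 0ℤ → y < 0ℤ → x ~ y
  <0⇒~ { -[1+ _ ]} { -[1+ _ ]} _ _ = same-sign (ℤ.+<+ z<s)
  <0⇒~ {+ _} (ℤ.+<+ ())
  <0⇒~ { -[1+ _ ]} {+ _} _ (ℤ.+<+ ())

  ~⇒0< : ∀ {x y} → x ~ y → 0ℤ < x → 0ℤ < y
  ~⇒0< {x} {y} x~y 0<x = subst (0ℤ <_) (ℤ.*-identityˡ y) (0<x*y (~-trans (0<⇒~ {1ℤ} (ℤ.+<+ z<s) 0<x) x~y))

  ~⇒<0 : ∀ {x y} → x ~ y → x < 0ℤ → y < 0ℤ
  ~⇒<0 x~y x<0 = ℤ.neg-cancel-< (~⇒0< (~-neg x~y) (ℤ.neg-mono-< x<0))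

  *-absorbˡ : ∀ {p x y} → 0ℤ < p → x ~ y → p * x ~ y
  *-absorbˡ {p} {x} {y} 0<p (same-sign q) =
    same-sign (subst (0ℤ <_) (sym (ℤ.*-assoc p x y)) (0<x,0<y⇒0<x*y {p} {x * y} 0<p q))

  *-absorbʳ : ∀ {p x y} → 0ℤ < p → x ~ y → x * p ~ y
  *-absorbʳ {p} {x} {y} 0<p x~y = subst (_~ y) (ℤ.*-comm p x) (*-absorbˡ 0<p x~y)

  0<∏ : ∀ {n} {f : Vector ℤ n} → (∀ i → 0ℤ < f i) → 0ℤ < ∏ f
  0<∏ {zero}  _   = ℤ.+<+ z<s
  0<∏ {suc n} {f} 0<f = 0<x,0<y⇒0<x*y {f zero} (0<f zero) (0<∏ (0<f ∘ suc))

  ∣y∣<∣x∣⇒x+y~x : ∀ x y → ∣ y ∣ ℕ.< ∣ x ∣ → x + y ~ x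
  ∣y∣<∣x∣⇒x+y~x +[1+ m ] (+ n)    _       = same-sign (ℤ.+<+ z<s)
  ∣y∣<∣x∣⇒x+y~x +[1+ m ] -[1+ n ] n<m     = 0<⇒~
    (subst (0ℤ <_) (sym (ℤ.⊖-≥ (ℕ.<⇒≤ n<m))) (ℤ.+<+ (ℕ.m<n⇒0<n∸m n<m))) (ℤ.+<+ z<s)
  ∣y∣<∣x∣⇒x+y~x -[1+ m ] -[1+ n ] _       = same-sign (ℤ.+<+ z<s)
  ∣y∣<∣x∣⇒x+y~x -[1+ m ] (+ n)    n<m     = <0⇒~
    (subst (_< 0ℤ) (sym (ℤ.⊖-< n<m)) (ℤ.neg-mono-< (ℤ.+<+ (ℕ.m<n⇒0<n∸m n<m)))) ℤ.-<+

  -- Divided difference weights, scaled to integers.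

  module Weights (N : ℕ) where

    C : ℤ
    C = + (N !)

    -- C / x for 0 < ∣ x ∣ ≤ N, so that all weights are integers.  The value 1 at 0
    -- makes the factor j = i in weight s i harmless.
    inv : ℤ → ℤ
    inv (+ 0)    = 1ℤ
    inv +[1+ n ] = + (N ! ℕ./ suc n)
    inv -[1+ n ] = - (+ (N ! ℕ./ suc n))

    *-inv : ∀ {x} → x ≢ 0ℤ → ∣ x ∣ ℕ.≤ N → x * inv x ≡ C
    *-inv {x} x≢0 ∣x∣≤N = go x x≢0 ∣x∣≤N
      where
      quotient : ∀ n → suc n ℕ.≤ N → + suc n * + (N ! ℕ./ suc n) ≡ C
      quotient n n<N = trans (sym (ℤ.pos-* (suc n) _))
        (cong +_ (ℕ.m*[n/m]≡n (ℕ.∣-trans (ℕ.m∣m*n (n !)) (ℕ.m≤n⇒m!∣n! n<N))))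
      go : ∀ x → x ≢ 0ℤ → ∣ x ∣ ℕ.≤ N → x * inv x ≡ C
      go (+ 0)    x≢0 _ = contradiction refl x≢0
      go +[1+ n ] _ n<N = quotient n n<N
      go -[1+ n ] _ n<N = trans (eq (+ suc n) _) (quotient n n<N)
        where
        eq : ∀ x y → (- x) * (- y) ≡ x * y
        eq = solve-∀

    0<C : 0ℤ < C
    0<C = ℤ.+<+ (ℕ.1≤n! N)

    Spread : ∀ {n} → Vector ℤ n → Set
    Spread s = ∀ i j → i ≢ j → s j - s i ≢ 0ℤ × ∣ s j - s i ∣ ℕ.≤ N

    -- For `n` spread nodes this is the divided difference weight times `C` to the power n - 1.
    weight : ∀ {n} → Vector ℤ n → Vector ℤ n
    weight s i = ∏ λ j → inv (s j - s i)

    ∑w : ∀ {n} → Vector ℤ n → (ℤ → ℤ) → ℤ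
    ∑w s φ = sum λ i → weight s i * φ (s i)

    -- The factor `head s - t` kills the term of the first node, and in every other weight it turns
    -- the factor of that node into `C`.
    ∑w-deflate₀ : ∀ {n} (s : Vector ℤ (suc n)) → Spread s → ∀ φ →
      ∑w s (λ t → (head s - t) * φ t) ≡ C * ∑w (tail s) φ
    ∑w-deflate₀ s spread φ = begin
      weight s zero * ((s zero - s zero) * φ (s zero))
        + sum (λ i → weight s (suc i) * ((s zero - s (suc i)) * φ (s (suc i))))
        ≡⟨ cong₂ _+_ (zeroTerm (weight s zero) (s zero) (φ (s zero))) (sum-cong-≗ sucTerm) ⟩
      0ℤ + sum (λ i → C * (weight (tail s) i * φ (s (suc i))))
        ≡⟨ ℤ.+-identityˡ _ ⟩
      sum (λ i → C * (weight (tail s) i * φ (s (suc i))))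
        ≡⟨ *-distribˡ-sum C (λ i → weight (tail s) i * φ (s (suc i))) ⟨
      C * ∑w (tail s) φ ∎
      where
      open ≡-Reasoning
      zeroTerm : ∀ w x y → w * ((x - x) * y) ≡ 0ℤ
      zeroTerm = solve-∀
      assoc : ∀ x y z u → (x * y) * (z * u) ≡ (z * x) * (y * u)
      assoc = solve-∀
      sucTerm : ∀ i → weight s (suc i) * ((s zero - s (suc i)) * φ (s (suc i)))
              ≡ C * (weight (tail s) i * φ (s (suc i)))
      sucTerm i with x≢0 , x≤N ← spread (suc i) zero (λ ()) =
        trans (assoc (inv (s zero - s (suc i))) (weight (tail s) i) (s zero - s (suc i)) (φ (s (suc i))))
          (cong (_* (weight (tail s) i * φ (s (suc i)))) (*-inv x≢0 x≤N))

    -- Brings the second node to the head, so that `tail (swap₀₁ s)` is `s` without it and the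
    -- second node can be removed like the first.
    swap₀₁ : ∀ {n} → Vector ℤ (2 ℕ.+ n) → Vector ℤ (2 ℕ.+ n)
    swap₀₁ s = s (suc zero) ∷ s zero ∷ tail (tail s)

    Spread-swap : ∀ {n} (s : Vector ℤ (2 ℕ.+ n)) → Spread s → Spread (swap₀₁ s)
    Spread-swap s spread zero          zero          i≢j = contradiction refl i≢j
    Spread-swap s spread zero          (suc zero)    i≢j = spread (suc zero) zero λ ()
    Spread-swap s spread zero          (suc (suc j)) i≢j = spread (suc zero) (suc (suc j)) λ ()
    Spread-swap s spread (suc zero)    zero          i≢j = spread zero (suc zero) λ ()
    Spread-swap s spread (suc zero)    (suc zero)    i≢j = contradiction refl i≢j
    Spread-swap s spread (suc zero)    (suc (suc j)) i≢j = spread zero (suc (suc j)) λ ()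
    Spread-swap s spread (suc (suc i)) zero          i≢j = spread (suc (suc i)) (suc zero) λ ()
    Spread-swap s spread (suc (suc i)) (suc zero)    i≢j = spread (suc (suc i)) zero λ ()
    Spread-swap s spread (suc (suc i)) (suc (suc j)) i≢j = spread (suc (suc i)) (suc (suc j)) i≢j

    Spread-tail : ∀ {n} (s : Vector ℤ (suc n)) → Spread s → Spread (tail s)
    Spread-tail s spread i j i≢j = spread (suc i) (suc j) (i≢j ∘ Fin.suc-injective)

    ∑w-swap : ∀ {n} (s : Vector ℤ (2 ℕ.+ n)) φ → ∑w s φ ≡ ∑w (swap₀₁ s) φ
    ∑w-swap s φ = trans
      (cong₂ _+_ (swapFactors (s zero)) (cong₂ _+_ (swapFactors (s (suc zero)))
        (sum-cong-≗ λ i → swapFactors (s (suc (suc i))))))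
      (ℤ+.x∙yz≈y∙xz (weight (swap₀₁ s) (suc zero) * _) (weight (swap₀₁ s) zero * _) _)
      where
      swapFactors : ∀ t {z y} → inv (s zero - t) * (inv (s (suc zero) - t) * z) * y
                              ≡ inv (s (suc zero) - t) * (inv (s zero - t) * z) * y
      swapFactors t = cong (_* _) (ℤ*.x∙yz≈y∙xz (inv (s zero - t)) (inv (s (suc zero) - t)) _)

    ∑w-deflate₁ : ∀ {n} (s : Vector ℤ (2 ℕ.+ n)) → Spread s → ∀ φ →
      ∑w s (λ t → (s (suc zero) - t) * φ t) ≡ C * ∑w (tail (swap₀₁ s)) φ
    ∑w-deflate₁ s spread φ =
      trans (∑w-swap s (λ t → (s (suc zero) - t) * φ t))
        (∑w-deflate₀ (swap₀₁ s) (Spread-swap s spread) φ)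

    ∑w-linear : ∀ {n} (s : Vector ℤ n) φ ψ a b →
      ∑w s (λ t → a * φ t + b * ψ t) ≡ a * ∑w s φ + b * ∑w s ψ
    ∑w-linear s φ ψ a b = begin
      sum (λ i → weight s i * (a * φ (s i) + b * ψ (s i)))
        ≡⟨ sum-cong-≗ (λ i → distrib (weight s i) a b (φ (s i)) (ψ (s i))) ⟩
      sum (λ i → a * (weight s i * φ (s i)) + b * (weight s i * ψ (s i)))
        ≡⟨ ∑-distrib-+ (λ i → a * (weight s i * φ (s i))) (λ i → b * (weight s i * ψ (s i))) ⟩
      sum (λ i → a * (weight s i * φ (s i))) + sum (λ i → b * (weight s i * ψ (s i)))
        ≡⟨ cong₂ _+_ (*-distribˡ-sum a (λ i → weight s i * φ (s i)))
                     (*-distribˡ-sum b (λ i → weight s i * ψ (s i))) ⟨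
      a * ∑w s φ + b * ∑w s ψ ∎
      where
      open ≡-Reasoning
      distrib : ∀ w a b x y → w * (a * x + b * y) ≡ a * (w * x) + b * (w * y)
      distrib = solve-∀

    ∑w-cong : ∀ {n} (s : Vector ℤ n) {φ ψ} → (∀ t → φ t ≡ ψ t) → ∑w s φ ≡ ∑w s ψ
    ∑w-cong s φ≗ψ = sum-cong-≗ λ i → cong (weight s i *_) (φ≗ψ (s i))

    -- ∑w s is the divided difference at s, up to a factor.  As in the usual
    -- recursion, (s₁ − s₀) ∑w s is C times the difference of the functionals of s
    -- without s₀ and of s without s₁.
    lead : ℕ → ℤ
    lead zero    = 1ℤ
    lead (suc n) = - C * lead n

    ∑w-power : ∀ {n} (s : Vector ℤ (suc n)) → Spread s →
      (∀ {k} → k ℕ.< n → ∑w s (_^ k) ≡ 0ℤ) × ∑w s (_^ n) ≡ lead n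
    ∑w-power {zero} s spread = (λ ()) , eq
      where
      eq : (inv (s zero - s zero) * 1ℤ) * 1ℤ + 0ℤ ≡ 1ℤ
      -- The only factor is the default value `inv 0ℤ`, which is 1.
      eq rewrite ℤ.+-inverseʳ (s zero) = refl
    ∑w-power {suc n} s spread = vanish , (begin
        -- Writing t as x - (x - t) leaves a multiple of a vanishing lower power and a sum that
        -- deflates to the nodes without x.
        ∑w s (λ t → t * t ^ n)
          ≡⟨ ∑w-cong s (λ t → expand x t (t ^ n)) ⟩
        ∑w s (λ t → x * t ^ n + - 1ℤ * ((x - t) * t ^ n))
          ≡⟨ ∑w-linear s (_^ n) (λ t → (x - t) * t ^ n) x (- 1ℤ) ⟩
        x * ∑w s (_^ n) + - 1ℤ * ∑w s (λ t → (x - t) * t ^ n)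
          ≡⟨ cong₂ (λ a b → x * a + - 1ℤ * b) (vanish ℕ.≤-refl) (deflated₀ n) ⟩
        x * 0ℤ + - 1ℤ * (C * ∑w s₀ (_^ n))
          ≡⟨ cong (λ a → x * 0ℤ + - 1ℤ * (C * a)) (proj₂ ih₀) ⟩
        x * 0ℤ + - 1ℤ * (C * lead n)
          ≡⟨ collect x C (lead n) ⟩
        - C * lead n ∎)
      where
      open ≡-Reasoning
      x y : ℤ
      x = s zero
      y = s (suc zero)
      s₀ s₁ : Vector ℤ (suc n)
      s₀ = tail s
      s₁ = tail (swap₀₁ s)
      ih₀ = ∑w-power s₀ (Spread-tail s spread)
      ih₁ = ∑w-power s₁ (Spread-tail (swap₀₁ s) (Spread-swap s spread))
      deflated₀ : ∀ k → ∑w s (λ t → (x - t) * t ^ k) ≡ C * ∑w s₀ (_^ k)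
      deflated₀ k = ∑w-deflate₀ s spread (_^ k)
      expand : ∀ x t p → t * p ≡ x * p + - 1ℤ * ((x - t) * p)
      expand = solve-∀
      collect : ∀ x c l → x * 0ℤ + - 1ℤ * (c * l) ≡ - c * l
      collect = solve-∀
      difference : ∀ x y t p → (y - x) * p ≡ 1ℤ * ((y - t) * p) + - 1ℤ * ((x - t) * p)
      difference = solve-∀
      distribute : ∀ w a p → w * (a * p) ≡ a * (w * p)
      distribute = solve-∀
      cancel : ∀ c a → 1ℤ * (c * a) + - 1ℤ * (c * a) ≡ 0ℤ
      cancel = solve-∀
      -- Lower powers give 0 on both sides; the power `n` gives `lead n`, whatever the nodes are.
      agree : ∀ {k} → k ℕ.< suc n → ∑w s₁ (_^ k) ≡ ∑w s₀ (_^ k)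
      agree {k} (s≤s k≤n) with ℕ.m≤n⇒m<n∨m≡n k≤n
      ... | inj₁ k<n  = trans (proj₁ ih₁ k<n) (sym (proj₁ ih₀ k<n))
      ... | inj₂ refl = trans (proj₂ ih₁) (sym (proj₂ ih₀))
      scaled : ∀ {k} → k ℕ.< suc n → (y - x) * ∑w s (_^ k) ≡ 0ℤ
      scaled {k} k<1+n = begin
        (y - x) * ∑w s (_^ k)
          ≡⟨ *-distribˡ-sum (y - x) (λ i → weight s i * s i ^ k) ⟩
        sum (λ i → (y - x) * (weight s i * s i ^ k))
          ≡⟨ sum-cong-≗ (λ i → distribute (weight s i) (y - x) (s i ^ k)) ⟨
        ∑w s (λ t → (y - x) * t ^ k)
          ≡⟨ ∑w-cong s (λ t → difference x y t (t ^ k)) ⟩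
        ∑w s (λ t → 1ℤ * ((y - t) * t ^ k) + - 1ℤ * ((x - t) * t ^ k))
          ≡⟨ ∑w-linear s (λ t → (y - t) * t ^ k) (λ t → (x - t) * t ^ k) 1ℤ (- 1ℤ) ⟩
        1ℤ * ∑w s (λ t → (y - t) * t ^ k) + - 1ℤ * ∑w s (λ t → (x - t) * t ^ k)
          ≡⟨ cong₂ (λ a b → 1ℤ * a + - 1ℤ * b)
               (trans (∑w-deflate₁ s spread (_^ k)) (cong (C *_) (agree k<1+n))) (deflated₀ k) ⟩
        1ℤ * (C * ∑w s₀ (_^ k)) + - 1ℤ * (C * ∑w s₀ (_^ k))
          ≡⟨ cancel C (∑w s₀ (_^ k)) ⟩
        0ℤ ∎
      vanish : ∀ {k} → k ℕ.< suc n → ∑w s (_^ k) ≡ 0ℤ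
      vanish {k} k<1+n = fromInj₂
        (λ y-x≡0 → contradiction y-x≡0 (proj₁ (spread zero (suc zero) λ ())))
        (ℤ.i*j≡0⇒i≡0∨j≡0 (y - x) (scaled {k} k<1+n))

    ∣inv∣≤N! : ∀ x → ∣ inv x ∣ ℕ.≤ N !
    ∣inv∣≤N! (+ 0)    = ℕ.1≤n! N
    ∣inv∣≤N! +[1+ n ] = ℕ.m/n≤m (N !) (suc n)
    ∣inv∣≤N! -[1+ n ] = subst (ℕ._≤ N !) (sym (ℤ.∣-i∣≡∣i∣ (+ (N ! ℕ./ suc n)))) (ℕ.m/n≤m (N !) (suc n))

    inv-~ : ∀ {x} → x ≢ 0ℤ → ∣ x ∣ ℕ.≤ N → inv x ~ x
    inv-~ {x} x≢0 ∣x∣≤N = ~-sym (same-sign (subst (0ℤ <_) (sym (*-inv x≢0 ∣x∣≤N)) 0<C))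

    ∣weight∣≤ : ∀ {n} (s : Vector ℤ n) i → ∣ weight s i ∣ ℕ.≤ (N !) ℕ.^ n
    ∣weight∣≤ s i = ∣∏∣≤ λ j → ∣inv∣≤N! (s j - s i)
      where
      ∣∏∣≤ : ∀ {n c} {f : Vector ℤ n} → (∀ i → ∣ f i ∣ ℕ.≤ c) → ∣ ∏ f ∣ ℕ.≤ c ℕ.^ n
      ∣∏∣≤ {zero} _ = ℕ.≤-refl
      ∣∏∣≤ {suc n} {c} {f} f≤c = subst (ℕ._≤ c ℕ.^ suc n) (sym (ℤ.abs-* (f zero) (∏ (tail f))))
        (ℕ.*-mono-≤ (f≤c zero) (∣∏∣≤ (f≤c ∘ suc)))

    inv≢0 : ∀ {n} {s : Vector ℤ n} → Spread s → ∀ i j → inv (s j - s i) ≢ 0ℤ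
    inv≢0 {s = s} spread i j with i Fin.≟ j
    ... | yes refl rewrite ℤ.+-inverseʳ (s i) = λ ()
    ... | no  i≢j  with x≢0 , x≤N ← spread i j i≢j = ~⇒≢0 (inv-~ x≢0 x≤N)

    weight≢0 : ∀ {n} {s : Vector ℤ n} → Spread s → ∀ i → weight s i ≢ 0ℤ
    weight≢0 {s = s} spread i = ∏≢0 (inv≢0 {s = s} spread i)
      where
      ∏≢0 : ∀ {n} {f : Vector ℤ n} → (∀ i → f i ≢ 0ℤ) → ∏ f ≢ 0ℤ
      ∏≢0 {zero}  _ ()
      ∏≢0 {suc n} {f} f≢0 eq with ℤ.i*j≡0⇒i≡0∨j≡0 (f zero) eq
      ... | inj₁ f₀≡0 = f≢0 zero f₀≡0
      ... | inj₂ ∏≡0  = ∏≢0 (f≢0 ∘ suc) ∏≡0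

  -- Sums with a dominating term.

  -- The `n` other terms, multiplied by `K`, add up to at most `n * c` times `∣ z m ∣` in absolute
  -- value. This is less than `K` times `∣ z m ∣`, so they cannot change the sign.
  sum-dominant : ∀ {n K c} (z : Vector ℤ (suc n)) m → z m ≢ 0ℤ → n ℕ.* c ℕ.< K →
    (∀ i → i ≢ m → K ℕ.* ∣ z i ∣ ℕ.≤ c ℕ.* ∣ z m ∣) → sum z ~ z m
  sum-dominant {n} {K} {c} z m zₘ≢0 n*c<K small = subst (_~ z m) (sym (sum-remove {i = m} z))
    (∣y∣<∣x∣⇒x+y~x (z m) (sum rest) (ℕ.*-cancelˡ-< K ∣ sum rest ∣ ∣ z m ∣ (ℕ.≤-<-trans
      (subst (K ℕ.* ∣ sum rest ∣ ℕ.≤_) (sym (ℕ.*-assoc n c ∣ z m ∣))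
        (scaled-∣sum∣≤ rest λ i → small (punchIn m i) (Fin.punchInᵢ≢i m i)))
      (ℕ.*-monoˡ-< ∣ z m ∣ {{ℕ.≢-nonZero (zₘ≢0 ∘ ℤ.∣i∣≡0⇒i≡0)}} n*c<K))))
    where
    rest : Vector ℤ n
    rest = removeAt z m
    scaled-∣sum∣≤ : ∀ {n b} (t : Vector ℤ n) → (∀ i → K ℕ.* ∣ t i ∣ ℕ.≤ b) → K ℕ.* ∣ sum t ∣ ℕ.≤ n ℕ.* b
    scaled-∣sum∣≤ {zero} t _ = ℕ.≤-reflexive (ℕ.*-zeroʳ K)
    scaled-∣sum∣≤ {suc n} {b} t t≤b = begin
      K ℕ.* ∣ t zero + sum (tail t) ∣              ≤⟨ ℕ.*-monoʳ-≤ K (ℤ.∣i+j∣≤∣i∣+∣j∣ (t zero) _) ⟩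
      K ℕ.* (∣ t zero ∣ ℕ.+ ∣ sum (tail t) ∣)      ≡⟨ ℕ.*-distribˡ-+ K ∣ t zero ∣ _ ⟩
      K ℕ.* ∣ t zero ∣ ℕ.+ K ℕ.* ∣ sum (tail t) ∣  ≤⟨ ℕ.+-mono-≤ (t≤b zero) (scaled-∣sum∣≤ (tail t) (t≤b ∘ suc)) ⟩
      b ℕ.+ n ℕ.* b                                ∎
      where open ℕ.≤-Reasoning

  argmin : ∀ {n} (h : Fin (suc n) → ℕ) → ∃[ m ] (∀ i → h m ℕ.≤ h i)
  argmin {zero}  h = zero , λ { zero → ℕ.≤-refl }
  argmin {suc n} h with m , h[m]≤ ← argmin (h ∘ suc) with ℕ.≤-total (h zero) (h (suc m))
  ... | inj₁ h₀≤ = zero  , λ { zero → ℕ.≤-refl ; (suc i) → ℕ.≤-trans h₀≤ (h[m]≤ i) }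
  ... | inj₂ ≤h₀ = suc m , λ { zero → ≤h₀ ; (suc i) → h[m]≤ i }

  -- The configuration of nodes and values, for d = 2 + d′ and r = 2 + r′.

  module Configuration (d′ r′ : ℕ) where

    Index : Set
    Index = Fin (3 ℕ.+ d′) × Fin (2 ℕ.+ r′)

    -- The position along the line: a′ alone forms the leftmost block, in front of X₀.
    block : Index → Fin (4 ℕ.+ d′)
    block (suc zero , zero) = zero
    block (i        , _)    = suc i

    -- Smaller rank means larger absolute value.
    level : Fin (3 ℕ.+ d′) → Fin (3 ℕ.+ d′)
    level (suc zero)       = suc (suc zero)
    level (suc (suc zero)) = suc zero
    level i                = i

    rank : Index → ℕ
    rank (i , k) = toℕ (combine (level i) k)

    -- Bounds the nodes, hence their differences, and also the ranks, so that the truncated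
    -- subtraction in `value` loses nothing.
    N : ℕ
    N = (4 ℕ.+ d′) ℕ.* (2 ℕ.+ r′)

    open Weights N public

    node : Index → ℤ
    node q = + toℕ (combine (block q) (proj₂ q))

    polarity : Index → Sign
    polarity (zero           , k) = mark k
    polarity (suc (suc zero) , k) = mark k
    polarity _                    = Sign.+

    -- `base` exceeds d times the bound on the weights of d + 1 nodes, so that one step in rank
    -- outweighs all d other terms together.
    weightBound base : ℕ
    weightBound = (N !) ℕ.^ (3 ℕ.+ d′)
    base        = suc ((2 ℕ.+ d′) ℕ.* weightBound)

    value : Index → ℤ
    value q = polarity q ◃ base ℕ.^ (N ∸ rank q)

    value-~ : ∀ q → value q ~ unit (polarity q)
    value-~ q with polarity q | base ℕ.^ (N ∸ rank q) | ℕ.m^n>0 base (N ∸ rank q)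
    ... | Sign.+ | suc _ | _ = same-sign (ℤ.+<+ z<s)
    ... | Sign.- | suc _ | _ = same-sign (ℤ.+<+ z<s)

    node-injective : Injective _≡_ _≡_ node
    node-injective {q} {q′} eq
      with b , refl ← Fin.combine-injective (block q) (proj₂ q) (block q′) (proj₂ q′)
                        (Fin.toℕ-injective (ℤ.+-injective eq))
      = block-injective _ _ b
      where
      block-injective : ∀ i j {k} → block (i , k) ≡ block (j , k) → (i , k) ≡ (j , k)
      block-injective zero          zero          _ = refl
      block-injective zero          (suc zero)    {zero} ()
      block-injective zero          (suc zero)    {suc k} ()
      block-injective (suc zero)    zero          {zero} ()
      block-injective (suc zero)    zero          {suc k} ()
      block-injective (suc zero)    (suc zero)    _ = refl
      block-injective (suc zero)    (suc (suc j)) {zero} ()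
      block-injective (suc zero)    (suc (suc j)) {suc k} ()
      block-injective (suc (suc i)) (suc zero)    {zero} ()
      block-injective (suc (suc i)) (suc zero)    {suc k} ()
      block-injective (suc (suc i)) (suc (suc j)) refl = refl

    rank-injective : Injective _≡_ _≡_ rank
    rank-injective {i , k} {j , l} eq
      with p , refl ← Fin.combine-injective (level i) k (level j) l (Fin.toℕ-injective eq)
      = cong (_, k) (trans (sym (level-involutive i)) (trans (cong level p) (level-involutive j)))
      where
      level-involutive : ∀ i → level (level i) ≡ i
      level-involutive zero                = refl
      level-involutive (suc zero)          = refl
      level-involutive (suc (suc zero))    = refl
      level-involutive (suc (suc (suc i))) = refl

    rank≤N : ∀ q → rank q ℕ.≤ N
    rank≤N (i , k) = ℕ.≤-trans (ℕ.<⇒≤ (Fin.toℕ<n (combine (level i) k)))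
      (ℕ.*-monoˡ-≤ (2 ℕ.+ r′) (ℕ.n≤1+n (3 ℕ.+ d′)))

    ∣value∣ : ∀ q → ∣ value q ∣ ≡ base ℕ.^ (N ∸ rank q)
    ∣value∣ q = ℤ.abs-◃ (polarity q) _

    value-decay : ∀ {p q} → rank p ℕ.< rank q → base ℕ.* ∣ value q ∣ ℕ.≤ ∣ value p ∣
    value-decay {p} {q} p<q rewrite ∣value∣ p | ∣value∣ q =
      ℕ.^-monoʳ-≤ base (ℕ.∸-monoʳ-< p<q (rank≤N q))

    node-separated : ∀ {p q} → p ≢ q → node q - node p ≢ 0ℤ × ∣ node q - node p ∣ ℕ.≤ N
    node-separated {p} {q} p≢q =
      (λ eq → p≢q (sym (node-injective (ℤ.i-j≡0⇒i≡j _ _ eq)))) ,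
      ℕ.≤-trans
        (subst (ℕ._≤ toℕ q̂ ℕ.⊔ toℕ p̂) (cong ∣_∣ (sym (ℤ.[+m]-[+n]≡m⊖n (toℕ q̂) (toℕ p̂))))
          (ℤ.∣m⊝n∣≤m⊔n (toℕ q̂) (toℕ p̂)))
        (ℕ.⊔-lub (ℕ.<⇒≤ (Fin.toℕ<n q̂)) (ℕ.<⇒≤ (Fin.toℕ<n p̂)))
      where
      p̂ q̂ : Fin N
      p̂ = combine (block p) (proj₂ p)
      q̂ = combine (block q) (proj₂ q)

    nodes-spread : ∀ {n} {s : Vector Index n} → Injective _≡_ _≡_ s → Spread (node ∘ s)
    nodes-spread s-injective i j i≢j = node-separated (i≢j ∘ s-injective)

    W : ∀ {n} → Vector Index n → Vector ℤ n
    W s = weight (node ∘ s)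

    -- For d + 1 distinct indices, this is the Δ of the overview times the positive number `C` to
    -- the power d.
    discrepancy : ∀ {n} → Vector Index n → ℤ
    discrepancy s = sum λ i → W s i * value (s i)

    -- The weight at `m` is a nonzero integer, hence at least 1 in absolute value, and the others
    -- are at most `weightBound`. The loss from the weights is thus made up for by the factor `base`
    -- between values of different rank.
    discrepancy-~ : ∀ {s : Vector Index (3 ℕ.+ d′)} → Injective _≡_ _≡_ s → ∀ m →
      (∀ i → i ≢ m → rank (s m) ℕ.< rank (s i)) → discrepancy s ~ W s m * value (s m)
    discrepancy-~ {s} s-injective m m-least = sum-dominant {K = base} {c = weightBound} term m
      termₘ≢0 ℕ.≤-refl small
      where
      open ℕ.≤-Reasoning
      w : Vector ℤ (3 ℕ.+ d′)
      w = W s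
      term : Vector ℤ (3 ℕ.+ d′)
      term i = w i * value (s i)
      wₘ≢0 : w m ≢ 0ℤ
      wₘ≢0 = weight≢0 {s = node ∘ s} (nodes-spread s-injective) m
      termₘ≢0 : term m ≢ 0ℤ
      termₘ≢0 eq with ℤ.i*j≡0⇒i≡0∨j≡0 (w m) eq
      ... | inj₁ wₘ≡0 = wₘ≢0 wₘ≡0
      ... | inj₂ vₘ≡0 = ~⇒≢0 (value-~ (s m)) vₘ≡0
      small : ∀ i → i ≢ m → base ℕ.* ∣ term i ∣ ℕ.≤ weightBound ℕ.* ∣ term m ∣
      small i i≢m = begin
        base ℕ.* ∣ w i * value (s i) ∣
          ≡⟨ cong (base ℕ.*_) (ℤ.abs-* (w i) (value (s i))) ⟩
        base ℕ.* (∣ w i ∣ ℕ.* ∣ value (s i) ∣)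
          ≡⟨ ℕ*.x∙yz≈y∙xz base ∣ w i ∣ _ ⟩
        ∣ w i ∣ ℕ.* (base ℕ.* ∣ value (s i) ∣)
          ≤⟨ ℕ.*-mono-≤ (∣weight∣≤ (node ∘ s) i) (value-decay {s m} {s i} (m-least i i≢m)) ⟩
        weightBound ℕ.* ∣ value (s m) ∣
          ≤⟨ ℕ.*-monoʳ-≤ weightBound (ℕ.m≤n*m _ ∣ w m ∣ {{ℕ.≢-nonZero (wₘ≢0 ∘ ℤ.∣i∣≡0⇒i≡0)}}) ⟩
        weightBound ℕ.* (∣ w m ∣ ℕ.* ∣ value (s m) ∣)
          ≡⟨ cong (weightBound ℕ.*_) (ℤ.abs-* (w m) (value (s m))) ⟨
        weightBound ℕ.* ∣ w m * value (s m) ∣ ∎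

    discrepancy≢0 : ∀ {s : Vector Index (3 ℕ.+ d′)} → Injective _≡_ _≡_ s → discrepancy s ≢ 0ℤ
    discrepancy≢0 {s} s-injective with m , m-least ← argmin (rank ∘ s) =
      ~⇒≢0 (discrepancy-~ {s} s-injective m λ i i≢m →
        ℕ.≤∧≢⇒< (m-least i) (λ eq → i≢m (sym (s-injective (rank-injective eq)))))

    -- The factor of q in the weight of p.
    gap : Index → Index → ℤ
    gap p q = inv (node q - node p)

    private
      gap-~ : ∀ p q → block p ≢ block q → gap p q ~ node q - node p
      gap-~ p q p≢q with x≢0 , x≤N ← node-separated {p} {q} (p≢q ∘ cong block) = inv-~ x≢0 x≤N

      0<difference : ∀ p q → block p Fin.< block q → 0ℤ < node q - node p
      0<difference p q p<q = subst (_< node q - node p) (ℤ.+-inverseʳ (node p))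
        (ℤ.+-monoˡ-< (- node p) (ℤ.+<+ (Fin.combine-monoˡ-< (proj₂ p) (proj₂ q) p<q)))

    0<gap : ∀ p q → block p Fin.< block q → 0ℤ < gap p q
    0<gap p q p<q = ~⇒0< (~-sym (gap-~ p q (Fin.<⇒≢ p<q))) (0<difference p q p<q)

    gap<0 : ∀ p q → block q Fin.< block p → gap p q < 0ℤ
    gap<0 p q q<p = ~⇒<0 (~-sym (gap-~ p q (Fin.<⇒≢ q<p ∘ sym)))
      (subst (_< 0ℤ) (eq (node p) (node q)) (ℤ.neg-mono-< (0<difference q p q<p)))
      where
      eq : ∀ x y → - (x - y) ≡ y - x
      eq = solve-∀

    0<gap-refl : ∀ p → 0ℤ < gap p p
    0<gap-refl p rewrite ℤ.+-inverseʳ (node p) = ℤ.+<+ z<s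

    -- The nodes of X₀ lie to the right of a′ and to the left of the rest of X₁, so only the mark of
    -- the member of X₁ matters.
    gap₀₁-~ : ∀ l k → gap (zero , l) (suc zero , k) ~ - unit (mark k)
    gap₀₁-~ l zero    = <0⇒~ (gap<0 (zero , l) (suc zero , zero) z<s) ℤ.-<+
    gap₀₁-~ l (suc k) = 0<⇒~ (0<gap (zero , l) (suc zero , suc k) (s<s z<s)) (ℤ.+<+ z<s)

    gap₁₀-~ : ∀ k l → gap (suc zero , k) (zero , l) ~ unit (mark k)
    gap₁₀-~ zero    l = 0<⇒~ (0<gap (suc zero , zero) (zero , l) z<s) (ℤ.+<+ z<s)
    gap₁₀-~ (suc k) l = <0⇒~ (gap<0 (suc zero , suc k) (zero , l) (s<s z<s)) ℤ.-<+

    -- Opposite marks mean that exactly one of the two members is a′, the leftmost node.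
    gap₁₁-~ : ∀ k l → mark l ≡ opposite (mark k) → gap (suc zero , k) (suc zero , l) ~ unit (mark k)
    gap₁₁-~ zero    (suc l) _ = 0<⇒~ (0<gap (suc zero , zero) (suc zero , suc l) z<s) (ℤ.+<+ z<s)
    gap₁₁-~ (suc k) zero    _ = <0⇒~ (gap<0 (suc zero , suc k) (suc zero , zero) z<s) ℤ.-<+
    gap₁₁-~ zero    zero    ()
    gap₁₁-~ (suc k) (suc l) ()

    block₁< : ∀ k i l → block (suc zero , k) Fin.< block (suc (suc i) , l)
    block₁< zero    i l = z<s
    block₁< (suc k) i l = s<s (s<s z<s)

    0<gap₁ : ∀ k i l → 0ℤ < gap (suc zero , k) (suc (suc i) , l)
    0<gap₁ k i l = 0<gap (suc zero , k) (suc (suc i) , l) (block₁< k i l)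

    gap₁<0 : ∀ i l k → gap (suc (suc i) , l) (suc zero , k) < 0ℤ
    gap₁<0 i l k = gap<0 (suc (suc i) , l) (suc zero , k) (block₁< k i l)

    row : (Fin (3 ℕ.+ d′) → Fin (2 ℕ.+ r′)) → Vector Index (3 ℕ.+ d′)
    row A i = i , A i

    row-injective : ∀ A → Injective _≡_ _≡_ (row A)
    row-injective A eq = cong proj₁ eq

    rank-mono : ∀ i j k l → level i Fin.< level j → rank (i , k) ℕ.< rank (j , l)
    rank-mono i j k l = Fin.combine-monoˡ-< k l

    rank₀< : ∀ k i l → rank (zero , k) ℕ.< rank (suc i , l)
    rank₀< k zero          l = rank-mono zero (suc zero) k l z<s
    rank₀< k (suc zero)    l = rank-mono zero (suc (suc zero)) k l z<s
    rank₀< k (suc (suc i)) l = rank-mono zero (suc (suc (suc i))) k l z<s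

    -- The member of X₀ dominates. In its weight the nodes from X₂ on lie to the right and give
    -- positive factors, which leaves the factor of the member of X₁.
    discrepancy-row-~ : ∀ A → discrepancy (row A) ~ - unit (mark (A (suc zero))) * unit (mark (A zero))
    discrepancy-row-~ A = ~-trans (discrepancy-~ {row A} (row-injective A) zero least)
      (~-*-cong {x = W (row A) zero}
        (*-absorbˡ (0<gap-refl τ) (*-absorbʳ (0<∏ λ i → 0<gap τ (row A (suc (suc i))) (s<s z<s))
          (gap₀₁-~ (A zero) (A (suc zero)))))
        (value-~ τ))
      where
      τ : Index
      τ = zero , A zero
      least : ∀ i → i ≢ zero → rank τ ℕ.< rank (row A i)
      least zero    0≢0 = contradiction refl 0≢0
      least (suc i) _   = rank₀< (A zero) i (A (suc i))

    -- Signs for two parts on different sides of both dichotomies.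

    module Certificate
      (A B : Fin (3 ℕ.+ d′) → Fin (2 ℕ.+ r′))
      (opposite₀ : mark (B zero) ≡ opposite (mark (A zero)))
      (opposite₁ : mark (B (suc zero)) ≡ opposite (mark (A (suc zero))))
      (balanced  : mark (A (suc (suc zero))) ≡ mark (A zero) Sign.* mark (A (suc zero)))
      where

      -- The new index takes the place of the member of X₀ at the head, so that the remaining
      -- weights differ from those of `row A` only in their first factor.
      mixed : Vector Index (3 ℕ.+ d′)
      mixed = (suc zero , B (suc zero)) ∷ tail (row A)

      mixed-injective : Injective _≡_ _≡_ mixed
      mixed-injective {zero}        {zero}        _  = refl
      mixed-injective {zero}        {suc zero}    eq =
        contradiction (trans (sym (cong (mark ∘ proj₂) eq)) opposite₁) (s≢opposite[s] _)
      mixed-injective {suc zero}    {zero}        eq =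
        contradiction (trans (cong (mark ∘ proj₂) eq) opposite₁) (s≢opposite[s] _)
      mixed-injective {suc zero}    {suc zero}    _  = refl
      mixed-injective {suc (suc i)} {suc (suc j)} refl = refl

      a₀ a₁ : Sign
      a₀ = mark (A zero)
      a₁ = mark (A (suc zero))

      -- The new node lies on the same side of each remaining node as the old one. If `A` contains
      -- a′, both are to the right of a′; otherwise the new node is a′, and both are to the left of
      -- the member of `A` in X₁. The nodes from X₂ on are to the right of both.
      weight-tail-~ : ∀ i → W mixed (suc i) ~ W (row A) (suc i)
      weight-tail-~ i = ~-*-cong (first i)
        (≢0⇒~-refl (weight≢0 {s = tail (node ∘ row A)}
          (Spread-tail (node ∘ row A) (nodes-spread (row-injective A))) i))
        where
        first : ∀ i → gap (row A (suc i)) (suc zero , B (suc zero)) ~ gap (row A (suc i)) (zero , A zero)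
        first zero    = ~-trans (gap₁₁-~ _ _ opposite₁) (~-sym (gap₁₀-~ _ _))
        first (suc i) = <0⇒~ (gap₁<0 i (A (suc (suc i))) (B (suc zero)))
                             (gap<0 (row A (suc (suc i))) (zero , A zero) (s<s z<s))

      -- Each weight has just one factor of variable sign, that of the member of `A` in X₁ or of `B`
      -- in X₀. Both of these nodes lie to the right of `β` if `β` is a′, and to its left otherwise.
      weight-head-~ : W mixed zero ~ W (row B) (suc zero)
      weight-head-~ = ~-trans {y = unit (mark (B (suc zero)))}
        (*-absorbˡ (0<gap-refl β) (*-absorbʳ (0<∏ λ i → 0<gap₁ (B (suc zero)) i (A (suc (suc i))))
          (gap₁₁-~ (B (suc zero)) (A (suc zero))
            (trans (sym (opposite-involutive a₁)) (cong opposite (sym opposite₁))))))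
        (~-sym (*-absorbʳ
          (0<x,0<y⇒0<x*y (0<gap-refl β) (0<∏ λ i → 0<gap₁ (B (suc zero)) i (B (suc (suc i)))))
          (gap₁₀-~ (B (suc zero)) (B zero))))
        where
        β : Index
        β = suc zero , B (suc zero)

      -- Passing from `A` to `B` flips both marks, hence preserves their product.
      discrepancies-~ : discrepancy (row A) ~ discrepancy (row B)
      discrepancies-~ = ~-trans (discrepancy-row-~ A) (~-sym (~-trans (discrepancy-row-~ B)
        (units (mark (B zero)) (mark (B (suc zero))) opposite₀ opposite₁)))
        where
        units : ∀ b₀ b₁ → b₀ ≡ opposite a₀ → b₁ ≡ opposite a₁ → - unit b₁ * unit b₀ ~ - unit a₁ * unit a₀
        units _ _ refl refl with a₀ | a₁
        ... | Sign.+ | Sign.+ = same-sign (ℤ.+<+ z<s)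
        ... | Sign.+ | Sign.- = same-sign (ℤ.+<+ z<s)
        ... | Sign.- | Sign.+ = same-sign (ℤ.+<+ z<s)
        ... | Sign.- | Sign.- = same-sign (ℤ.+<+ z<s)

      -- Without X₀ the member of X₂ dominates. Its weight is positive because exactly two nodes,
      -- those of X₁, lie to its left.
      discrepancy-mixed-~ : discrepancy mixed ~ unit (mark (A (suc (suc zero))))
      discrepancy-mixed-~ = ~-trans (discrepancy-~ {mixed} mixed-injective (suc (suc zero)) least)
        (*-absorbˡ {p = W mixed (suc (suc zero))} positive (value-~ b))
        where
        b : Index
        b = suc (suc zero) , A (suc (suc zero))
        least : ∀ i → i ≢ suc (suc zero) → rank b ℕ.< rank (mixed i)
        least zero                _   = rank-mono (suc (suc zero)) (suc zero) (proj₂ b) (B (suc zero)) (s<s z<s)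
        least (suc zero)          _   = rank-mono (suc (suc zero)) (suc zero) (proj₂ b) (A (suc zero)) (s<s z<s)
        least (suc (suc zero))    i≢2 = contradiction refl i≢2
        least (suc (suc (suc i))) _   =
          rank-mono (suc (suc zero)) (suc (suc (suc i))) (proj₂ b) (A (suc (suc (suc i)))) (s<s z<s)
        positive : 0ℤ < W mixed (suc (suc zero))
        positive = subst (0ℤ <_) (ℤ.*-assoc (gap b (mixed zero)) (gap b (mixed (suc zero))) _)
          (0<x,0<y⇒0<x*y
            (0<x*y (<0⇒~ (gap₁<0 zero (A (suc (suc zero))) (B (suc zero)))
                         (gap₁<0 zero (A (suc (suc zero))) (A (suc zero)))))
            (0<x,0<y⇒0<x*y (0<gap-refl b)
              (0<∏ λ i → 0<gap b (mixed (suc (suc (suc i)))) (s<s (s<s (s<s z<s))))))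

      -- Here `balanced` enters: it makes the sign of `discrepancy mixed` the product of `a₀` and
      -- `a₁`, while `row A` has the opposite sign.
      discrepancy-row-~-mixed : discrepancy (row A) ~ - discrepancy mixed
      discrepancy-row-~-mixed = ~-trans (discrepancy-row-~ A)
        (~-sym (~-trans (~-neg discrepancy-mixed-~) (units (mark (A (suc (suc zero)))) balanced)))
        where
        units : ∀ s → s ≡ a₀ Sign.* a₁ → - unit s ~ - unit a₁ * unit a₀
        units _ refl with a₀ | a₁
        ... | Sign.+ | Sign.+ = same-sign (ℤ.+<+ z<s)
        ... | Sign.+ | Sign.- = same-sign (ℤ.+<+ z<s)
        ... | Sign.- | Sign.+ = same-sign (ℤ.+<+ z<s)
        ... | Sign.- | Sign.- = same-sign (ℤ.+<+ z<s)

open IntegerWeights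

-- The canonical homomorphism from the integers to a commutative ring.

module IntegerEmbedding {c ℓ} (A : CommutativeRing c ℓ) where

  open CommutativeRing A hiding (zero)
  open import Algebra.Properties.Ring ring
    using (-0#≈0#; -‿distribˡ-*; -‿+-comm; -‿involutive)
  open import Algebra.Properties.Semiring.Mult semiring
    using (×-homo-+; ×1-homo-*; ×-homo-1) renaming (_×_ to _·_)
  open import Algebra.Properties.Semiring.Sum semiring using (sum)
  open import Relation.Binary.Reasoning.Setoid setoid

  ι : ℤ → Carrier
  ι (+ n)    = n · 1#
  ι -[1+ n ] = - (suc n · 1#)

  ι-1 : ι 1ℤ ≈ 1#
  ι-1 = ×-homo-1 1#

  ι-neg : ∀ x → ι (ℤ.- x) ≈ - ι x
  ι-neg (+ 0)    = sym -0#≈0#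
  ι-neg +[1+ n ] = refl
  ι-neg -[1+ n ] = sym (-‿involutive _)

  ι-⊖ : ∀ m n → ι (m ℤ.⊖ n) ≈ m · 1# - n · 1#
  ι-⊖ m       zero    = sym (trans (+-congˡ -0#≈0#) (+-identityʳ _))
  ι-⊖ zero    (suc n) = sym (+-identityˡ _)
  ι-⊖ (suc m) (suc n) = begin
    ι (suc m ℤ.⊖ suc n)                    ≡⟨ ≡.cong ι (ℤ.[1+m]⊖[1+n]≡m⊖n m n) ⟩
    ι (m ℤ.⊖ n)                            ≈⟨ ι-⊖ m n ⟩
    m · 1# - n · 1#                        ≈⟨ +-congʳ (+-identityˡ _) ⟨
    (0# + m · 1#) - n · 1#                 ≈⟨ +-congʳ (+-congʳ (-‿inverseʳ 1#)) ⟨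
    ((1# - 1#) + m · 1#) - n · 1#          ≈⟨ +-congʳ (+-assoc _ _ _) ⟩
    (1# + (- 1# + m · 1#)) - n · 1#        ≈⟨ +-congʳ (+-congˡ (+-comm _ _)) ⟩
    (1# + (m · 1# - 1#)) - n · 1#          ≈⟨ +-congʳ (+-assoc _ _ _) ⟨
    ((1# + m · 1#) - 1#) - n · 1#          ≈⟨ +-assoc _ _ _ ⟩
    (1# + m · 1#) + (- 1# - n · 1#)        ≈⟨ +-congˡ (-‿+-comm _ _) ⟩
    suc m · 1# - suc n · 1#                ∎

  ι-+ : ∀ x y → ι (x ℤ.+ y) ≈ ι x + ι y
  ι-+ (+ m)    (+ n)    = ×-homo-+ 1# m n
  ι-+ (+ m)    -[1+ n ] = ι-⊖ m (suc n)
  ι-+ -[1+ m ] (+ n)    = trans (ι-⊖ n (suc m)) (+-comm _ _)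
  ι-+ -[1+ m ] -[1+ n ] = begin
    - (suc (suc (m ℕ.+ n)) · 1#)       ≡⟨ ≡.cong (λ k → - (suc k · 1#)) (ℕ.+-suc m n) ⟨
    - ((suc m ℕ.+ suc n) · 1#)         ≈⟨ -‿cong (×-homo-+ 1# (suc m) (suc n)) ⟩
    - (suc m · 1# + suc n · 1#)        ≈⟨ -‿+-comm _ _ ⟨
    - (suc m · 1#) - (suc n · 1#)      ∎

  ι-* : ∀ x y → ι (x ℤ.* y) ≈ ι x * ι y
  ι-* x y = begin
    ι (x ℤ.* y) ≡⟨ ≡.cong ι (ℤ.*-comm x y) ⟩
    ι (y ℤ.* x) ≈⟨ bilinear y x (λ n → trans (reflexive (≡.cong ι (ℤ.*-comm y (+ n))))
                                      (trans (bilinear (+ n) y (nonneg n)) (*-comm _ _))) ⟩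
    ι y * ι x   ≈⟨ *-comm _ _ ⟩
    ι x * ι y   ∎
    where
    nonneg : ∀ m n → ι (+ m ℤ.* + n) ≈ ι (+ m) * ι (+ n)
    nonneg m n = trans (reflexive (≡.cong ι (≡.sym (ℤ.pos-* m n)))) (×1-homo-* m n)
    -- Reduces the second factor to a natural number; with commutativity it is applied once to each
    -- factor.
    bilinear : ∀ x y → (∀ n → ι (x ℤ.* + n) ≈ ι x * ι (+ n)) → ι (x ℤ.* y) ≈ ι x * ι y
    bilinear x (+ n)    hyp = hyp n
    bilinear x -[1+ n ] hyp = begin
      ι (x ℤ.* -[1+ n ])        ≡⟨ ≡.cong ι (ℤ.neg-distribʳ-* x +[1+ n ]) ⟨
      ι (ℤ.- (x ℤ.* +[1+ n ]))  ≈⟨ ι-neg (x ℤ.* +[1+ n ]) ⟩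
      - ι (x ℤ.* +[1+ n ])      ≈⟨ -‿cong (hyp (suc n)) ⟩
      - (ι x * ι +[1+ n ])      ≈⟨ -‿cong (*-comm _ _) ⟩
      - (ι +[1+ n ] * ι x)      ≈⟨ -‿distribˡ-* _ _ ⟩
      ι -[1+ n ] * ι x          ≈⟨ *-comm _ _ ⟩
      ι x * ι -[1+ n ]          ∎

  ι-sum : ∀ {n} (f : Vector ℤ n) → ι (sumℤ f) ≈ sum (ι ∘ f)
  ι-sum {zero}  f = refl
  ι-sum {suc n} f = trans (ι-+ (f zero) _) (+-congˡ (ι-sum (f ∘ suc)))

-- Order, sums and integers in the real numbers.

module RealProperties {c ℓ₁ ℓ₂} (R : RealNumbers c ℓ₁ ℓ₂) where

  open RealNumbers R
  open CommutativeRing commutativeRing public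
    hiding (Carrier; _≈_; _+_; _*_; -_; 0#; 1#; _-_; setoid; +-rawMonoid; zero)
  open import Algebra.Properties.Ring ring public
    using (-0#≈0#; -‿distribˡ-*; -‿distribʳ-*; -‿involutive; -1*x≈-x; x[y-z]≈xy-xz)
  open import Algebra.Properties.CommutativeSemigroup *-commutativeSemigroup public
    using (x∙yz≈y∙xz)
  open import Algebra.Properties.Semiring.Sum semiring public
    using (sum-cong-≋; sum-remove; sum-replicate-zero; *-distribˡ-sum; *-distribʳ-sum; ∑-comm; ∑-distrib-+)
  open import Algebra.Apartness.Properties.HeytingCommutativeRing heytingCommutativeRing public
    using (1#0)
  open IntegerEmbedding commutativeRing public
  open IsStrictPartialOrder <-isStrictPartialOrder public
    using () renaming (irrefl to <-irrefl; trans to <-trans; <-respʳ-≈ to <-respʳ; <-respˡ-≈ to <-respˡ)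
  open import Algebra.Apartness.Structures _≈_ _#_ _+_ _*_ -_ 0# 1# using (IsHeytingField)
  open IsHeytingField isHeytingField using (tight; #⇒invertible)
  open import Relation.Binary.Reasoning.Setoid setoid

  x<0⇒0<-x : ∀ {x} → x < 0# → 0# < - x
  x<0⇒0<-x {x} x<0 = <-respʳ (+-identityˡ _) (<-respˡ (-‿inverseʳ x) (+-monoˡ-< (- x) x<0))

  0<-x⇒x<0 : ∀ {x} → 0# < - x → x < 0#
  0<-x⇒x<0 {x} 0<-x = <-respʳ (-‿inverseˡ x) (<-respˡ (+-identityˡ x) (+-monoˡ-< x 0<-x))

  -- Apartness leaves 1 < 0 to be excluded, in which case (-1)(-1) = 1 would be positive.
  0<1 : 0# < 1#
  0<1 with 1#0
  ... | inj₂ 0<1 = 0<1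
  ... | inj₁ 1<0 = contradiction
    (<-trans 1<0 (<-respʳ (begin
      - 1# * - 1#      ≈⟨ -‿distribˡ-* _ _ ⟨
      - (1# * - 1#)    ≈⟨ -‿cong (*-identityˡ _) ⟩
      - - 1#           ≈⟨ -‿involutive 1# ⟩
      1#               ∎) (*-positive (x<0⇒0<-x 1<0) (x<0⇒0<-x 1<0))))
    (<-irrefl refl)

  +-positive : ∀ {x y} → 0# < x → 0# < y → 0# < x + y
  +-positive {x} {y} 0<x 0<y = <-trans 0<y (<-respˡ (+-identityˡ y) (+-monoˡ-< y 0<x))

  ι-positive : ∀ {x} → 0ℤ ℤ.< x → 0# < ι x
  ι-positive {+ 0}            (ℤ.+<+ ())
  ι-positive {+[1+ zero ]}    _ = <-respʳ (sym ι-1) 0<1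
  ι-positive {+[1+ suc n ]}   _ = +-positive 0<1 (ι-positive {+[1+ n ]} (ℤ.+<+ z<s))

  ι-apart : ∀ {x} → x ≢ 0ℤ → ι x # 0#
  ι-apart {+ 0}       x≢0 = contradiction ≡.refl x≢0
  ι-apart {+[1+ n ]}  _   = inj₂ (ι-positive {+[1+ n ]} (ℤ.+<+ z<s))
  ι-apart { -[1+ n ]} _   = inj₁ (0<-x⇒x<0 (<-respʳ (sym (-‿involutive _)) (ι-positive {+[1+ n ]} (ℤ.+<+ z<s))))

  x*ι≈0⇒x≈0 : ∀ {x} z → z ≢ 0ℤ → x * ι z ≈ 0# → x ≈ 0#
  x*ι≈0⇒x≈0 {x} z z≢0 eq with w , _ , right ← #⇒invertible (ι-apart z≢0) = begin
    x                     ≈⟨ *-identityʳ x ⟨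
    x * 1#                ≈⟨ *-congˡ right ⟨
    x * ((ι z - 0#) * w)  ≈⟨ *-congˡ (*-congʳ (trans (+-congˡ -0#≈0#) (+-identityʳ _))) ⟩
    x * (ι z * w)         ≈⟨ *-assoc _ _ _ ⟨
    (x * ι z) * w         ≈⟨ *-congʳ eq ⟩
    0# * w                ≈⟨ zeroˡ w ⟩
    0#                    ∎

  ι≈0⇒≡0 : ∀ x → ι x ≈ 0# → x ≡ 0ℤ
  ι≈0⇒≡0 x eq with x ℤ.≟ 0ℤ
  ... | yes x≡0 = x≡0
  ... | no  x≢0 = contradiction eq (apart⇒≉ (ι-apart x≢0))
    where
    apart⇒≉ : ∀ {y} → y # 0# → ¬ y ≈ 0#
    apart⇒≉ (inj₁ y<0) y≈0 = <-irrefl y≈0 y<0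
    apart⇒≉ (inj₂ 0<y) y≈0 = <-irrefl (sym y≈0) 0<y

  nonneg-≈ : ∀ {x y} → x ≈ y → 0# ≤ x → 0# ≤ y
  nonneg-≈ x≈y 0≤x y<0 = 0≤x (<-respˡ (sym x≈y) y<0)

  -- Although the order is not decidable, the cases y ≈ 0 and 0 < y may be
  -- distinguished in the proof of a negation.
  nonneg-cases : ∀ {y p} {P : Set p} → 0# ≤ y → (0# < y → ¬ P) → (y ≈ 0# → ¬ P) → ¬ P
  nonneg-cases 0≤y pos zer p = zer (proj₁ (tight _ _) λ { (inj₁ y<0) → 0≤y y<0 ; (inj₂ 0<y) → pos 0<y p }) p

  *-nonneg : ∀ {x y} → 0# < x → 0# ≤ y → 0# ≤ x * y
  *-nonneg {x} {y} 0<x 0≤y = nonneg-cases 0≤y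
    (λ 0<y xy<0 → <-irrefl refl (<-trans (*-positive 0<x 0<y) xy<0))
    (λ y≈0 → <-irrefl (trans (*-congˡ y≈0) (zeroʳ x)))

  *-cancelˡ-nonneg : ∀ {x y} → 0# < x → 0# ≤ x * y → 0# ≤ y
  *-cancelˡ-nonneg {x} {y} 0<x 0≤xy y<0 = 0≤xy (0<-x⇒x<0
    (<-respʳ (sym (-‿distribʳ-* x y)) (*-positive 0<x (x<0⇒0<-x y<0))))

  +-nonneg : ∀ {x y} → 0# ≤ x → 0# ≤ y → 0# ≤ x + y
  +-nonneg {x} {y} 0≤x 0≤y = nonneg-cases 0≤y
    (λ 0<y x+y<0 → 0≤x (<-trans (<-respˡ (+-identityˡ x) (<-respʳ (+-comm y x) (+-monoˡ-< x 0<y))) x+y<0))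
    (λ y≈0 x+y<0 → 0≤x (<-respˡ (trans (+-congˡ y≈0) (+-identityʳ x)) x+y<0))

  sum-nonneg : ∀ {n} {f : Vector Carrier n} → (∀ i → 0# ≤ f i) → 0# ≤ sum f
  sum-nonneg {zero}  _   = <-irrefl refl
  sum-nonneg {suc n} 0≤f = +-nonneg (0≤f zero) (sum-nonneg (0≤f ∘ suc))

  sum-zero : ∀ {n} {f : Vector Carrier n} → (∀ i → f i ≈ 0#) → sum f ≈ 0#
  sum-zero {n} f≈0 = trans (sum-cong-≋ f≈0) (sum-replicate-zero n)

  sum-single : ∀ {n} {f : Vector Carrier n} i → (∀ j → j ≢ i → f j ≈ 0#) → sum f ≈ f i
  sum-single {suc n} {f} i f≈0 = trans (sum-remove {i = i} f)
    (trans (+-congˡ (sum-zero λ j → f≈0 (punchIn i j) (Fin.punchInᵢ≢i i j))) (+-identityʳ _))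

-- Hyperplanes with normals on the moment curve.

module MomentCurve {c ℓ₁ ℓ₂} (R : RealNumbers c ℓ₁ ℓ₂) where

  open RealNumbers R
  open RealProperties R
  open Geometry R
  open import Relation.Binary.Reasoning.Setoid setoid

  -- Induction on `n`: multiplying each coefficient by the difference of its node and the first node
  -- removes the first term, and the new moments combine two consecutive old ones. Once the other
  -- coefficients vanish, the moment of order 0 yields the first.
  vandermonde-independent : ∀ {n} (t : Vector ℤ n) → (∀ i j → i ≢ j → t j ℤ.- t i ≢ 0ℤ) →
    (a : Vector Carrier n) → (∀ {k} → k ℕ.< n → sum (λ i → a i * ι (t i ℤ.^ k)) ≈ 0#) → ∀ i → a i ≈ 0#
  vandermonde-independent {suc n} t distinct a moments = a≈0
    where
    scaled : Vector Carrier (suc n)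
    scaled i = a i * ι (t i ℤ.- t zero)

    split : ∀ i k → scaled i * ι (t i ℤ.^ k) ≈ a i * ι (t i ℤ.^ suc k) + - ι (t zero) * (a i * ι (t i ℤ.^ k))
    split i k = begin
      (a i * ι (t i ℤ.- t zero)) * ι (t i ℤ.^ k)
        ≈⟨ *-congʳ (*-congˡ (trans (ι-+ (t i) (ℤ.- t zero)) (+-congˡ (ι-neg (t zero))))) ⟩
      (a i * (ι (t i) + - ι (t zero))) * ι (t i ℤ.^ k)
        ≈⟨ *-congʳ (distribˡ _ _ _) ⟩
      (a i * ι (t i) + a i * - ι (t zero)) * ι (t i ℤ.^ k)
        ≈⟨ distribʳ _ _ _ ⟩
      a i * ι (t i) * ι (t i ℤ.^ k) + a i * - ι (t zero) * ι (t i ℤ.^ k)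
        ≈⟨ +-cong (trans (*-assoc _ _ _) (*-congˡ (sym (ι-* (t i) (t i ℤ.^ k)))))
                  (trans (*-congʳ (*-comm _ _)) (*-assoc _ _ _)) ⟩
      a i * ι (t i ℤ.^ suc k) + - ι (t zero) * (a i * ι (t i ℤ.^ k)) ∎

    scaled-moments : ∀ {k} → k ℕ.< n → sum (λ i → scaled (suc i) * ι (t (suc i) ℤ.^ k)) ≈ 0#
    scaled-moments {k} k<n = begin
      sum (λ i → scaled (suc i) * ι (t (suc i) ℤ.^ k))
        ≈⟨ +-identityˡ _ ⟨
      0# + sum (λ i → scaled (suc i) * ι (t (suc i) ℤ.^ k))
        ≈⟨ +-congʳ (trans (*-congʳ (trans (*-congˡ (reflexive (≡.cong ι (ℤ.+-inverseʳ (t zero)))))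
             (zeroʳ _))) (zeroˡ _)) ⟨
      sum (λ i → scaled i * ι (t i ℤ.^ k))
        ≈⟨ sum-cong-≋ (λ i → split i k) ⟩
      sum (λ i → a i * ι (t i ℤ.^ suc k) + - ι (t zero) * (a i * ι (t i ℤ.^ k)))
        ≈⟨ ∑-distrib-+ (λ i → a i * ι (t i ℤ.^ suc k)) (λ i → - ι (t zero) * (a i * ι (t i ℤ.^ k))) ⟩
      sum (λ i → a i * ι (t i ℤ.^ suc k)) + sum (λ i → - ι (t zero) * (a i * ι (t i ℤ.^ k)))
        ≈⟨ +-cong (moments (s<s k<n)) (trans (sym (*-distribˡ-sum (- ι (t zero)) (λ i → a i * ι (t i ℤ.^ k))))
             (*-congˡ (moments (ℕ.m<n⇒m<1+n k<n)))) ⟩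
      0# + - ι (t zero) * 0#
        ≈⟨ trans (+-identityˡ _) (zeroʳ _) ⟩
      0# ∎

    tail≈0 : ∀ i → a (suc i) ≈ 0#
    tail≈0 i = x*ι≈0⇒x≈0 (t (suc i) ℤ.- t zero) (distinct zero (suc i) λ ())
      (vandermonde-independent (tail t) (λ i j i≢j → distinct (suc i) (suc j) (i≢j ∘ Fin.suc-injective))
        (tail scaled) scaled-moments i)

    a≈0 : ∀ i → a i ≈ 0#
    a≈0 (suc i) = tail≈0 i
    a≈0 zero    = begin
      a zero                           ≈⟨ *-identityʳ _ ⟨
      a zero * 1#                      ≈⟨ *-congˡ ι-1 ⟨
      a zero * ι 1ℤ                    ≈⟨ sum-single {f = λ i → a i * ι (t i ℤ.^ 0)} zero
                                            (λ { zero    0≢0 → contradiction ≡.refl 0≢0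
                                               ; (suc i) _   → trans (*-congʳ (tail≈0 i)) (zeroˡ _) }) ⟨
      sum (λ i → a i * ι (t i ℤ.^ 0))  ≈⟨ moments z<s ⟩
      0#                               ∎

  -- Its product with `x` is the value at `t` of the polynomial with coefficients `x`.
  momentVector : ∀ {d} → ℤ → Point d
  momentVector t k = ι (t ℤ.^ toℕ k)

  residual : ∀ {d} → Point d → Carrier → Point d → Carrier
  residual u b x = b - u ∙ x

  ∙-linearCombination : ∀ {n d} (u : Point d) (w : Vector Carrier n) (v : Vector (Point d) n) →
    u ∙ linearCombination w v ≈ sum (λ j → w j * (u ∙ v j))
  ∙-linearCombination u w v = begin
    sum (λ k → u k * sum (λ j → w j * v j k))
      ≈⟨ sum-cong-≋ (λ k → *-distribˡ-sum (u k) (λ j → w j * v j k)) ⟩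
    sum (λ k → sum (λ j → u k * (w j * v j k)))
      ≈⟨ ∑-comm (λ k j → u k * (w j * v j k)) ⟩
    sum (λ j → sum (λ k → u k * (w j * v j k)))
      ≈⟨ sum-cong-≋ (λ j → trans (sum-cong-≋ λ k → x∙yz≈y∙xz (u k) (w j) (v j k))
           (sym (*-distribˡ-sum (w j) (λ k → u k * v j k)))) ⟩
    sum (λ j → w j * (u ∙ v j)) ∎

  sum-sub : ∀ {n} (f g : Vector Carrier n) → sum (λ j → f j - g j) ≈ sum f - sum g
  sum-sub f g = begin
    sum (λ j → f j - g j)          ≈⟨ ∑-distrib-+ f (λ j → - g j) ⟩
    sum f + sum (λ j → - g j)      ≈⟨ +-congˡ (sum-cong-≋ λ j → sym (-1*x≈-x (g j))) ⟩
    sum f + sum (λ j → - 1# * g j) ≈⟨ +-congˡ (trans (sym (*-distribˡ-sum (- 1#) g)) (-1*x≈-x (sum g))) ⟩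
    sum f - sum g                  ∎

  -- The residual is affine in the point: as the weights sum to 1, the constant `b` can be spread
  -- over the terms.
  residual-convex : ∀ {n d} (u : Point d) b (w : Vector Carrier n) (v : Vector (Point d) n) x → sum w ≈ 1# →
    (∀ k → x k ≈ linearCombination w v k) → residual u b x ≈ sum (λ j → w j * residual u b (v j))
  residual-convex u b w v x ∑w≈1 x≈ = begin
    b - u ∙ x
      ≈⟨ +-cong (sym (*-identityˡ b))
           (-‿cong (trans (sum-cong-≋ λ k → *-congˡ {u k} (x≈ k)) (∙-linearCombination u w v))) ⟩
    1# * b - sum (λ j → w j * (u ∙ v j))
      ≈⟨ +-congʳ (trans (*-congʳ (sym ∑w≈1)) (*-distribʳ-sum b w)) ⟩
    sum (λ j → w j * b) - sum (λ j → w j * (u ∙ v j))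
      ≈⟨ sum-sub (λ j → w j * b) (λ j → w j * (u ∙ v j)) ⟨
    sum (λ j → w j * b - w j * (u ∙ v j))
      ≈⟨ sum-cong-≋ (λ j → sym (x[y-z]≈xy-xz (w j) b (u ∙ v j))) ⟩
    sum (λ j → w j * (b - u ∙ v j)) ∎

  module _ {n d} (a t f : Vector ℤ n)
           (vanishing : ∀ (k : Fin d) → sumℤ (λ i → a i ℤ.* t i ℤ.^ toℕ k) ≡ 0ℤ) where

    private
      e : Point d → Vector Carrier n
      e x i = residual (momentVector (t i)) (ι (f i)) x

    -- The products are values of a polynomial of degree < d at the nodes, and by `vanishing` the
    -- weights annihilate each of its monomials.
    ∑-weighted-normals : ∀ (x : Point d) → sum (λ i → ι (a i) * (momentVector (t i) ∙ x)) ≈ 0#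
    ∑-weighted-normals x = begin
      sum (λ i → ι (a i) * sum (λ k → ι (t i ℤ.^ toℕ k) * x k))
        ≈⟨ sum-cong-≋ (λ i → trans (*-distribˡ-sum (ι (a i)) (λ k → ι (t i ℤ.^ toℕ k) * x k))
             (sum-cong-≋ λ k → sym (*-assoc (ι (a i)) (ι (t i ℤ.^ toℕ k)) (x k)))) ⟩
      sum (λ i → sum (λ k → ι (a i) * ι (t i ℤ.^ toℕ k) * x k))
        ≈⟨ ∑-comm (λ i k → ι (a i) * ι (t i ℤ.^ toℕ k) * x k) ⟩
      sum (λ k → sum (λ i → ι (a i) * ι (t i ℤ.^ toℕ k) * x k))
        ≈⟨ sum-zero coordinate ⟩
      0# ∎
      where
      coordinate : ∀ (k : Fin d) → sum (λ i → ι (a i) * ι (t i ℤ.^ toℕ k) * x k) ≈ 0#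
      coordinate k = begin
        sum (λ i → ι (a i) * ι (t i ℤ.^ toℕ k) * x k)
          ≈⟨ *-distribʳ-sum (x k) (λ i → ι (a i) * ι (t i ℤ.^ toℕ k)) ⟨
        sum (λ i → ι (a i) * ι (t i ℤ.^ toℕ k)) * x k
          ≈⟨ *-congʳ (sum-cong-≋ λ i → sym (ι-* (a i) (t i ℤ.^ toℕ k))) ⟩
        sum (λ i → ι (a i ℤ.* t i ℤ.^ toℕ k)) * x k
          ≈⟨ *-congʳ (ι-sum (λ i → a i ℤ.* t i ℤ.^ toℕ k)) ⟨
        ι (sumℤ (λ i → a i ℤ.* t i ℤ.^ toℕ k)) * x k
          ≈⟨ *-congʳ (reflexive (≡.cong ι (vanishing k))) ⟩
        0# * x k
          ≈⟨ zeroˡ _ ⟩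
        0# ∎

    ∑-weighted-residuals : ∀ x → sum (λ i → ι (a i) * e x i) ≈ ι (sumℤ λ i → a i ℤ.* f i)
    ∑-weighted-residuals x = begin
      sum (λ i → ι (a i) * (ι (f i) - momentVector (t i) ∙ x))
        ≈⟨ sum-cong-≋ (λ i → trans (x[y-z]≈xy-xz (ι (a i)) (ι (f i)) (momentVector (t i) ∙ x))
             (+-congʳ (sym (ι-* (a i) (f i))))) ⟩
      sum (λ i → ι (a i ℤ.* f i) - ι (a i) * (momentVector (t i) ∙ x))
        ≈⟨ sum-sub (λ i → ι (a i ℤ.* f i)) (λ i → ι (a i) * (momentVector (t i) ∙ x)) ⟩
      sum (λ i → ι (a i ℤ.* f i)) - sum (λ i → ι (a i) * (momentVector (t i) ∙ x))
        ≈⟨ +-cong (sym (ι-sum (λ i → a i ℤ.* f i))) (trans (-‿cong (∑-weighted-normals x)) -0#≈0#) ⟩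
      ι (sumℤ λ i → a i ℤ.* f i) + 0#
        ≈⟨ +-identityʳ _ ⟩
      ι (sumℤ λ i → a i ℤ.* f i) ∎

    -- If v i lies on every hyperplane but the i-th, then the weighted residual
    -- of v i at the i-th one is the whole sum, and convexity passes this on to x.
    convexHull-residual : ∀ (v : Vector (Point d) n) →
      (∀ k i → i ≢ k → momentVector (t i) ∙ v k ≈ ι (f i)) → ∀ (w : Vector Carrier n) → sum w ≈ 1# →
      ∀ x → (∀ k → x k ≈ linearCombination w v k) → ∀ i →
      ι (a i) * e x i ≈ w i * ι (sumℤ λ i → a i ℤ.* f i)
    convexHull-residual v vertices w ∑w≈1 x x≈ i = begin
      ι (a i) * e x i
        ≈⟨ *-congˡ (residual-convex (momentVector (t i)) (ι (f i)) w v x ∑w≈1 x≈) ⟩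
      ι (a i) * sum (λ j → w j * e (v j) i)
        ≈⟨ *-congˡ (sum-single {f = λ j → w j * e (v j) i} i λ j j≢i →
             trans (*-congˡ (onFacet j i (j≢i ∘ ≡.sym))) (zeroʳ _)) ⟩
      ι (a i) * (w i * e (v i) i)
        ≈⟨ x∙yz≈y∙xz _ _ _ ⟩
      w i * (ι (a i) * e (v i) i)
        ≈⟨ *-congˡ (sum-single {f = λ j → ι (a j) * e (v i) j} i λ j j≢i →
             trans (*-congˡ (onFacet i j j≢i)) (zeroʳ _)) ⟨
      w i * sum (λ j → ι (a j) * e (v i) j)
        ≈⟨ *-congˡ (∑-weighted-residuals (v i)) ⟩
      w i * ι (sumℤ λ i → a i ℤ.* f i) ∎
      where
      onFacet : ∀ k j → j ≢ k → e (v k) j ≈ 0#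
      onFacet k j j≢k = trans (+-congˡ (-‿cong (vertices k j j≢k))) (-‿inverseʳ _)

-- The hyperplanes, their general position and disjoint simplices.

module Construction {c ℓ₁ ℓ₂} (R : RealNumbers c ℓ₁ ℓ₂) (d′ r′ : ℕ) where

  open RealNumbers R
  open RealProperties R
  open Geometry R
  open MomentCurve R
  open Configuration d′ r′
  open import Relation.Binary.Reasoning.Setoid setoid

  d : ℕ
  d = 2 ℕ.+ d′

  hyperplane : Index → Hyperplane d
  hyperplane q = record
    { normal   = momentVector (node q)
    ; offset   = ι (value q)
    -- The coordinate 0 is the power `t ^ 0`, that is 1.
    ; normal#0 = zero , inj₂ (ι-positive {1ℤ} (ℤ.+<+ z<s))
    }

  error : Point d → Index → Carrier
  error x q = residual (momentVector (node q)) (ι (value q)) x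

  W-vanishing : ∀ {s : Vector Index (suc d)} → Injective _≡_ _≡_ s →
    ∀ (k : Fin d) → sumℤ (λ i → W s i ℤ.* node (s i) ℤ.^ toℕ k) ≡ 0ℤ
  W-vanishing {s} s-injective k = proj₁ (∑w-power (node ∘ s) (nodes-spread s-injective)) (Fin.toℕ<n k)

  ∑-W-error : ∀ {s : Vector Index (suc d)} → Injective _≡_ _≡_ s → ∀ x →
    sum (λ i → ι (W s i) * error x (s i)) ≈ ι (discrepancy s)
  ∑-W-error {s} s-injective = ∑-weighted-residuals (W s) (node ∘ s) (value ∘ s) (W-vanishing s-injective)

  -- The factor `w` is the barycentric coordinate of `x` at the vertex opposite to the facet `i`.
  simplex-error : ∀ {s : Vector Index (suc d)} → Injective _≡_ _≡_ s → ∀ {x} → △ (hyperplane ∘ s) x →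
    ∀ i → ∃[ w ] (0# ≤ w × ι (W s i) * error x (s i) ≈ w * ι (discrepancy s))
  simplex-error {s} s-injective {x} (v , vertices , w , 0≤w , ∑w≈1 , x≈) i = w i , 0≤w i ,
    convexHull-residual (W s) (node ∘ s) (value ∘ s) (W-vanishing s-injective) v vertices w ∑w≈1 x x≈ i

  -- Normals at distinct nodes form a Vandermonde matrix. A common point of d + 1 hyperplanes would
  -- have all errors 0 and so force their discrepancy to be 0.
  generalPosition : GeneralPosition hyperplane
  generalPosition = independent , noCommonPoint
    where
    independent : ∀ (s : Fin d → Index) → Injective _≡_ _≡_ s → LinearlyIndependent (normal ∘ hyperplane ∘ s)
    independent s s-injective a eq = vandermonde-independent (node ∘ s)
      (λ i j i≢j → proj₁ (nodes-spread {s = s} s-injective i j i≢j)) a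
      λ {k} k<d → ≡.subst (λ l → sum (λ i → a i * ι (node (s i) ℤ.^ l)) ≈ 0#)
        (Fin.toℕ-fromℕ< k<d) (eq (Fin.fromℕ< k<d))
    noCommonPoint : ∀ (s : Fin (suc d) → Index) → Injective _≡_ _≡_ s → ¬ (∃[ x ] (∀ k → x ∈ʰ hyperplane (s k)))
    noCommonPoint s s-injective (x , x∈) = discrepancy≢0 {s} s-injective (ι≈0⇒≡0 (discrepancy s) (begin
      ι (discrepancy s)                            ≈⟨ ∑-W-error {s} s-injective x ⟨
      sum (λ i → ι (W s i) * error x (s i))        ≈⟨ sum-zero {f = λ i → ι (W s i) * error x (s i)} (λ i →
        trans (*-congˡ (trans (+-congˡ (-‿cong (x∈ i))) (-‿inverseʳ _))) (zeroʳ _)) ⟩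
      0#                                           ∎))

  -- Multiplying the equation by u l′ u′ makes its right side a positive integer times `w`, and its
  -- left side the desired product times the positive u². Thus the sign of the real `y` is never
  -- decided.
  sign-transfer : ∀ (u l u′ l′ : ℤ) {y} → u ~ u′ → l ~ l′ →
    ∃[ w ] (0# ≤ w × ι u * y ≈ w * ι l) → 0# ≤ ι l′ * (ι u′ * y)
  sign-transfer u l u′ l′ {y} u~u′ l~l′ (w , 0≤w , eq) =
    *-cancelˡ-nonneg (ι-positive (0<x*y (≢0⇒~-refl (~⇒≢0 u~u′))))
      (nonneg-≈ rearranged (*-nonneg (ι-positive {(u ℤ.* u′) ℤ.* (l ℤ.* l′)}
        (0<x,0<y⇒0<x*y {u ℤ.* u′} (0<x*y u~u′) (0<x*y l~l′))) 0≤w))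
    where
    rearranged : ι ((u ℤ.* u′) ℤ.* (l ℤ.* l′)) * w ≈ ι (u ℤ.* u) * (ι l′ * (ι u′ * y))
    rearranged = begin
      ι ((u ℤ.* u′) ℤ.* (l ℤ.* l′)) * w      ≡⟨ ≡.cong (λ z → ι z * w) (shuffle₁ u u′ l l′) ⟩
      ι ((u ℤ.* (l′ ℤ.* u′)) ℤ.* l) * w      ≈⟨ *-congʳ (ι-* (u ℤ.* (l′ ℤ.* u′)) l) ⟩
      (ι (u ℤ.* (l′ ℤ.* u′)) * ι l) * w      ≈⟨ trans (*-assoc _ _ _) (*-congˡ (*-comm _ _)) ⟩
      ι (u ℤ.* (l′ ℤ.* u′)) * (w * ι l)      ≈⟨ *-congˡ eq ⟨
      ι (u ℤ.* (l′ ℤ.* u′)) * (ι u * y)      ≈⟨ *-assoc _ _ _ ⟨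
      (ι (u ℤ.* (l′ ℤ.* u′)) * ι u) * y      ≈⟨ *-congʳ (ι-* (u ℤ.* (l′ ℤ.* u′)) u) ⟨
      ι ((u ℤ.* (l′ ℤ.* u′)) ℤ.* u) * y      ≡⟨ ≡.cong (λ z → ι z * y) (shuffle₂ u u′ l′) ⟩
      ι ((u ℤ.* u) ℤ.* (l′ ℤ.* u′)) * y      ≈⟨ trans (*-congʳ (ι-* (u ℤ.* u) (l′ ℤ.* u′))) (*-assoc _ _ _) ⟩
      ι (u ℤ.* u) * (ι (l′ ℤ.* u′) * y)      ≈⟨ *-congˡ (trans (*-congʳ (ι-* l′ u′)) (*-assoc _ _ _)) ⟩
      ι (u ℤ.* u) * (ι l′ * (ι u′ * y))      ∎
      where
      shuffle₁ : ∀ u u′ l l′ → (u ℤ.* u′) ℤ.* (l ℤ.* l′) ≡ (u ℤ.* (l′ ℤ.* u′)) ℤ.* l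
      shuffle₁ = solve-∀
      shuffle₂ : ∀ u u′ l′ → (u ℤ.* (l′ ℤ.* u′)) ℤ.* u ≡ (u ℤ.* u) ℤ.* (l′ ℤ.* u′)
      shuffle₂ = solve-∀

  -- For a common point, all terms of the weighted error sum over `mixed`, multiplied by `L`, are
  -- nonnegative: the head by membership in the simplex of `B`, the others by membership in that of
  -- `A`. But the sum is `L` times `discrepancy mixed`, which is negative.
  simplices-disjoint : ∀ A B →
    mark (B zero) ≡ opposite (mark (A zero)) →
    mark (B (suc zero)) ≡ opposite (mark (A (suc zero))) →
    mark (A (suc (suc zero))) ≡ mark (A zero) Sign.* mark (A (suc zero)) →
    Disjoint (△ (hyperplane ∘ row A)) (△ (hyperplane ∘ row B))
  simplices-disjoint A B opposite₀ opposite₁ balanced x (x∈△A , x∈△B) =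
    nonneg-≈ total (sum-nonneg {f = λ i → ι L * (ι (W mixed i) * error x (mixed i))} term≥0) negative
    where
    open Certificate A B opposite₀ opposite₁ balanced
    L : ℤ
    L = discrepancy (row A)
    term≥0 : ∀ i → 0# ≤ ι L * (ι (W mixed i) * error x (mixed i))
    term≥0 zero    = sign-transfer (W (row B) (suc zero)) (discrepancy (row B)) (W mixed zero) L
      (~-sym weight-head-~) (~-sym discrepancies-~) (simplex-error {row B} (row-injective B) x∈△B (suc zero))
    term≥0 (suc i) = sign-transfer (W (row A) (suc i)) L (W mixed (suc i)) L
      (~-sym (weight-tail-~ i)) (≢0⇒~-refl (discrepancy≢0 {row A} (row-injective A)))
      (simplex-error {row A} (row-injective A) x∈△A (suc i))
    total : sum (λ i → ι L * (ι (W mixed i) * error x (mixed i))) ≈ ι (L ℤ.* discrepancy mixed)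
    total = begin
      sum (λ i → ι L * (ι (W mixed i) * error x (mixed i)))
        ≈⟨ *-distribˡ-sum (ι L) (λ i → ι (W mixed i) * error x (mixed i)) ⟨
      ι L * sum (λ i → ι (W mixed i) * error x (mixed i))
        ≈⟨ *-congˡ (∑-W-error {mixed} mixed-injective x) ⟩
      ι L * ι (discrepancy mixed)
        ≈⟨ ι-* L (discrepancy mixed) ⟨
      ι (L ℤ.* discrepancy mixed) ∎
    negative : ι (L ℤ.* discrepancy mixed) < 0#
    negative = 0<-x⇒x<0 (<-respʳ
      (trans (reflexive (≡.cong ι (≡.sym (ℤ.neg-distribʳ-* L (discrepancy mixed)))))
        (ι-neg (L ℤ.* discrepancy mixed)))
      (ι-positive (0<x*y discrepancy-row-~-mixed)))

-- The choice of two suitable parts in a partition.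

mark-≢0 : ∀ {n} {k : Fin (suc n)} → k ≢ zero → mark k ≡ Sign.-
mark-≢0 {k = zero}  k≢0 = contradiction ≡.refl k≢0
mark-≢0 {k = suc _} _   = ≡.refl

module _ {d′ r′ : ℕ} (P : TransversalPartition (3 ℕ.+ d′) (2 ℕ.+ r′)) where

  open TransversalPartition P

  private
    r m : ℕ
    r = 2 ℕ.+ r′
    m = 3 ℕ.+ d′

  member : Fin r → Fin m → Fin r
  member j i = proj₁ (exactly-one i j)

  part-member : ∀ i j → part i (member j i) ≡ j
  part-member i j = proj₁ (proj₂ (exactly-one i j))

  member-part : ∀ i k → member (part i k) i ≡ k
  member-part i k = proj₂ (proj₂ (exactly-one i (part i k))) ≡.refl

  mark-member-≢ : ∀ i {j j′} → member j i ≡ zero → j′ ≢ j → mark (member j′ i) ≡ Sign.-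
  mark-member-≢ i {j} {j′} eq j′≢j = mark-≢0 λ eq′ →
    j′≢j (≡.trans (≡.sym (part-member i j′))
      (≡.trans (≡.cong (part i) (≡.trans eq′ (≡.sym eq))) (part-member i j)))

  Opposed : Fin r → Fin r → Set
  Opposed j j′ = j ≢ j′ ×
    mark (member j′ zero) ≡ opposite (mark (member j zero)) ×
    mark (member j′ (suc zero)) ≡ opposite (mark (member j (suc zero))) ×
    mark (member j (suc (suc zero))) ≡ mark (member j zero) Sign.* mark (member j (suc zero))

  -- The product of the marks on X₀ and X₁ is `s` for both parts, so either one can play the role of
  -- `A` if its mark on X₂ is `s`.
  orient : ∀ {j j′} s → j ≢ j′ →
    mark (member j zero) ≡ Sign.+ → mark (member j′ zero) ≡ Sign.- →
    mark (member j (suc zero)) ≡ s → mark (member j′ (suc zero)) ≡ opposite s →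
    mark (member j (suc (suc zero))) ≡ s ⊎ mark (member j′ (suc (suc zero))) ≡ s →
    ∃₂ Opposed
  orient {j} {j′} s j≢j′ a₀ b₀ a₁ b₁ (inj₁ a₂) = j , j′ , j≢j′ ,
    ≡.trans b₀ (≡.cong opposite (≡.sym a₀)) , ≡.trans b₁ (≡.cong opposite (≡.sym a₁)) ,
    ≡.trans a₂ (≡.sym (≡.cong₂ Sign._*_ a₀ a₁))
  orient {j} {j′} s j≢j′ a₀ b₀ a₁ b₁ (inj₂ b₂) = j′ , j , j≢j′ ∘ ≡.sym ,
    ≡.trans a₀ (≡.cong opposite (≡.sym b₀)) ,
    ≡.trans a₁ (≡.trans (≡.sym (opposite-involutive s)) (≡.cong opposite (≡.sym b₁))) ,
    ≡.trans b₂ (≡.trans (≡.sym (opposite-involutive s)) (≡.sym (≡.cong₂ Sign._*_ b₀ b₁)))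

  opposedPair : ∃₂ Opposed
  opposedPair = cases _ ≡.refl _ ≡.refl
    where
    -- The part that contains the first member of X₀ is always one of the two.
    j : Fin r
    j = part zero zero
    a₀ : mark (member j zero) ≡ Sign.+
    a₀ = ≡.cong mark (member-part zero zero)
    other₀ : ∀ {j′} → j ≢ j′ → mark (member j′ zero) ≡ Sign.-
    other₀ j≢j′ = mark-member-≢ zero (member-part zero zero) (j≢j′ ∘ ≡.sym)
    ≢part : ∀ i {k} → member j i ≡ suc k → j ≢ part i zero
    ≢part i eq j≡ with () ← ≡.trans (≡.sym eq) (≡.trans (≡.cong (λ j → member j i) j≡) (member-part i zero))
    cases : ∀ k₁ → member j (suc zero) ≡ k₁ → ∀ k₂ → member j (suc (suc zero)) ≡ k₂ → ∃₂ Opposed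
    -- If a′ is not in `j`, the other part is the one with a′. At most one of the two contains the
    -- first member of X₂, so one of them has the mark - there.
    cases (suc _) eq₁ k₂ eq₂ =
      orient Sign.- j≢j′ a₀ (other₀ j≢j′) (≡.cong mark eq₁)
        (≡.cong mark (member-part (suc zero) zero)) (side k₂ eq₂)
      where
      j≢j′ = ≢part (suc zero) eq₁
      side : ∀ k → member j (suc (suc zero)) ≡ k → _
      side zero    eq = inj₂ (mark-member-≢ (suc (suc zero)) eq (j≢j′ ∘ ≡.sym))
      side (suc _) eq = inj₁ (≡.cong mark eq)
    -- If `j` contains the first members of X₁ and X₂ too, any other part will do; there is one
    -- since r ≥ 2.
    cases zero eq₁ zero eq₂ =
      orient Sign.+ j≢j′ a₀ (other₀ j≢j′) (≡.cong mark eq₁)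
        (mark-member-≢ (suc zero) eq₁ (j≢j′ ∘ ≡.sym)) (inj₁ (≡.cong mark eq₂))
      where j≢j′ = Fin.punchInᵢ≢i j zero ∘ ≡.sym
    -- Otherwise the other part is the one with the first member of X₂, and it plays the role of
    -- `A`.
    cases zero eq₁ (suc _) eq₂ =
      orient Sign.+ j≢j′ a₀ (other₀ j≢j′) (≡.cong mark eq₁) (mark-member-≢ (suc zero) eq₁ (j≢j′ ∘ ≡.sym))
        (inj₂ (≡.cong mark (member-part (suc (suc zero)) zero)))
      where j≢j′ = ≢part (suc (suc zero)) eq₂

open import Data.Nat.Base using (_≤_)

theorem1p4 : ∀ {c ℓ₁ ℓ₂} (R : RealNumbers c ℓ₁ ℓ₂) (r d : ℕ) → 2 ≤ r → 2 ≤ d →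
    let open Geometry R
        open TransversalPartition
    in
    Σ[ X ∈ (Fin (suc d) → Fin r → Hyperplane d) ]
      (GeneralPosition (uncurry X) ×
       (∀ (P : TransversalPartition (suc d) r) →
          ∃₂ λ (j j′ : Fin r) → j ≢ j′ × Disjoint (△ (members P X j)) (△ (members P X j′))))
-- With this family, `members P X j` is `hyperplane ∘ row (member P j)` by definition.
theorem1p4 R (suc (suc r′)) (suc (suc d′)) (s≤s (s≤s _)) (s≤s (s≤s _)) =
  (λ i k → hyperplane (i , k)) , generalPosition , λ P →
    let j , j′ , j≢j′ , opposite₀ , opposite₁ , balanced = opposedPair P
    in j , j′ , j≢j′ , simplices-disjoint (member P j) (member P j′) opposite₀ opposite₁ balanced
  where open Construction R d′ r′
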